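{- Let $p$ be an odd prime, and write points of $(\mathbb Z_p^2)^2$ as $(k,\kappa)$ with $k=(k_0,k_1)$, $\kappa=(\kappa_0,\kappa_1)$. Define $\mathcal B_0=\{\{(k,\kappa):\kappa\in\mathbb Z_p^2\}:k\in\mathbb Z_p^2\}$; $\mathcal B_1=\{\{(k,Ak+b):k\in\mathbb Z_p^2\}:A\in\mathrm{Sym}_2(\mathbb Z_p),\ b\in\mathbb Z_p^2\}$; $\mathcal B_2=\{\{((c_0,k_1),(\kappa_0,ak_1+b)):k_1,\kappa_0\in\mathbb Z_p\}:a,b,c_0\in\mathbb Z_p\}$; $\mathcal B_3=\{\{((k_0,c_1),(ak_0+b,\kappa_1)):k_0,\kappa_1\in\mathbb Z_p\}:a,b,c_1\in\mathbb Z_p\}$; $\mathcal B_4=\{\{((k_0,\alpha k_0+\beta),(\kappa_0,(-1/\alpha)\kappa_0+ak_0+b)):k_0,\kappa_0\in\mathbb Z_p\}:\alpha,\beta,a,b\in\mathbb Z_p,\ \alpha\ne0\}$. Then $\widetilde{AG}(2,p^2)=\bigcup_{i=0}^4\mathcal B_i$ is a $(p^4,p^2,p+1)$-BIBD on the point set $(\mathbb Z_p^2)^2$.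
   Context: A $(v,k,\lambda)$-BIBD is a collection of $k$-element subsets (blocks) of a $v$-element point set such that every pair of distinct points lies in exactly $\lambda$ blocks. $\mathrm{Sym}_2(\mathbb Z_p)$ denotes symmetric $2\times2$ matrices over $\mathbb Z_p$. -}

module Defs where

open import Data.Nat using (ℕ; NonZero; _+_; _*_; _∸_; _≡ᵇ_)
open import Data.Nat.DivMod using (_mod_)
open import Data.Fin using (Fin; toℕ; zero) renaming (_≟_ to _≟F_)
open import Data.Fin.Properties using ()
open import Data.Bool using (Bool; true; false; if_then_else_; _∧_; not)
open import Data.Product using (_×_; _,_)
open import Data.Product.Properties using (≡-dec)
open import Data.Bool.ListAction using (any; all)
open import Data.List using (List; []; _∷_; map; concatMap; allFin; foldr; filterᵇ; deduplicateᵇ; deduplicate; length; _++_)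
open import Data.List.Membership.Propositional using (_∈_)
open import Relation.Binary.PropositionalEquality using (_≡_; _≢_)
open import Relation.Binary.Definitions using (DecidableEquality)
open import Relation.Nullary.Decidable using (isYes)

-- The point set is a type P with decidable equality, enumerated by the
-- list `pts` (which must contain every element of P).  A block is a
-- finite subset of P, given as a list of its elements (repetitions and
-- order irrelevant: blocks are compared as sets).  A design is the SET of
-- blocks obtained from a list of blocks by removing set-duplicates.

module _ {P : Set} (_≟_ : DecidableEquality P) (pts : List P) where

  memᵇ : P → List P → Bool
  memᵇ x B = any (λ y → isYes (x ≟ y)) B

  sameSetᵇ : List P → List P → Bool
  sameSetᵇ B C = all (λ x → eqB (memᵇ x B) (memᵇ x C)) pts
    where
    eqB : Bool → Bool → Bool
    eqB true  b = b
    eqB false b = not b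

  card : List P → ℕ
  card B = length (deduplicate _≟_ B)

  blockSet : List (List P) → List (List P)
  blockSet = deduplicateᵇ sameSetᵇ

  pairCount : List (List P) → P → P → ℕ
  pairCount blocks x y =
    length (filterᵇ (λ B → memᵇ x B ∧ memᵇ y B) (blockSet blocks))

  record IsBIBD (blocks : List (List P)) (v k λ′ : ℕ) : Set where
    field
      pts-complete : ∀ x → x ∈ pts
      pts-size     : card pts ≡ v
      block-size   : ∀ B → B ∈ blockSet blocks → card B ≡ k
      balanced     : ∀ x y → x ≢ y → pairCount blocks x y ≡ λ′

module _ (p : ℕ) .{{_ : NonZero p}} where

  Zp : Set
  Zp = Fin p

  _+p_ : Zp → Zp → Zp
  a +p b = (toℕ a + toℕ b) mod p

  _*p_ : Zp → Zp → Zp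
  a *p b = (toℕ a * toℕ b) mod p

  negp : Zp → Zp
  negp a = (p ∸ toℕ a) mod p

  -- 1/α : the (first, hence unique for prime p) x with α·x = 1 in ℤ_p
  -- (default 0 if none exists, e.g. α = 0, which never occurs below)
  invp : Zp → Zp
  invp α = foldr (λ x r → if toℕ (α *p x) ≡ᵇ 1 then x else r) (0 mod p) (allFin p)

  Zp2 : Set
  Zp2 = Zp × Zp

  Point : Set
  Point = Zp2 × Zp2

  _≟P_ : DecidableEquality Point
  _≟P_ = ≡-dec (≡-dec _≟F_ _≟F_) (≡-dec _≟F_ _≟F_)

  elemsZp : List Zp
  elemsZp = allFin p

  elemsZp2 : List Zp2
  elemsZp2 = concatMap (λ x → map (λ y → (x , y)) elemsZp) elemsZp

  allPoints : List Point
  allPoints = concatMap (λ k → map (λ κ → (k , κ)) elemsZp2) elemsZp2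

  -- Sym₂(ℤ_p): symmetric matrix [[a₀₀ , a₀₁],[a₀₁ , a₁₁]] stored as (a₀₀ , a₀₁ , a₁₁)
  Sym2 : Set
  Sym2 = Zp × Zp × Zp

  elemsSym2 : List Sym2
  elemsSym2 = concatMap (λ x → concatMap (λ y → map (λ z → (x , y , z)) elemsZp) elemsZp) elemsZp

  affine : Sym2 → Zp2 → Zp2 → Zp2
  affine (a00 , a01 , a11) (b0 , b1) (k0 , k1) =
    (((a00 *p k0) +p (a01 *p k1)) +p b0 , ((a01 *p k0) +p (a11 *p k1)) +p b1)

  𝓑₀ : List (List Point)
  𝓑₀ = map (λ k → map (λ κ → (k , κ)) elemsZp2) elemsZp2

  𝓑₁ : List (List Point)
  𝓑₁ = concatMap (λ A → map (λ b → map (λ k → (k , affine A b k)) elemsZp2) elemsZp2) elemsSym2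

  𝓑₂ : List (List Point)
  𝓑₂ = concatMap (λ a → concatMap (λ b → map (λ c0 →
         concatMap (λ k1 → map (λ κ0 → ((c0 , k1) , (κ0 , (a *p k1) +p b))) elemsZp) elemsZp)
       elemsZp) elemsZp) elemsZp

  𝓑₃ : List (List Point)
  𝓑₃ = concatMap (λ a → concatMap (λ b → map (λ c1 →
         concatMap (λ k0 → map (λ κ1 → ((k0 , c1) , ((a *p k0) +p b , κ1))) elemsZp) elemsZp)
       elemsZp) elemsZp) elemsZp

  nonzeroZp : List Zp
  nonzeroZp = filterᵇ (λ x → not (toℕ x ≡ᵇ 0)) elemsZp

  𝓑₄ : List (List Point)
  𝓑₄ = concatMap (λ α → concatMap (λ β → concatMap (λ a → map (λ b →
         concatMap (λ k0 → map (λ κ0 →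
           ((k0 , (α *p k0) +p β) ,
            (κ0 , ((negp (invp α) *p κ0) +p (a *p k0)) +p b))) elemsZp) elemsZp)
       elemsZp) elemsZp) elemsZp) nonzeroZp

  -- AG~(2,p²) = 𝓑₀ ∪ 𝓑₁ ∪ 𝓑₂ ∪ 𝓑₃ ∪ 𝓑₄  (as a set, via blockSet in IsBIBD)
  AGtilde : List (List Point)
  AGtilde = 𝓑₀ ++ 𝓑₁ ++ 𝓑₂ ++ 𝓑₃ ++ 𝓑₄

{-# OPTIONS --safe #-}
module Submission where

-- Write points as (k , κ) and the difference of two points x, x′ as ((d₀ , d₁) , (e₀ , e₁)).
-- Each block of a family is cut out by two equations, and after summing over the translation
-- parameter (b, β or c) the number of blocks of the family through x and x′ depends only on
-- the difference:
--   𝓑₀ : [d = 0],   𝓑₁ : #{A ∈ Sym₂ : A d = e},   𝓑₂ : [d₀ = 0]·#{a : a d₁ = e₁},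
--   𝓑₃ : [d₁ = 0]·#{a : a d₀ = e₀},   𝓑₄ : Σ_{α ≠ 0} [α d₀ = d₁]·#{a : -α⁻¹ e₀ + a d₀ = e₁}.
-- If d ≠ 0, the solutions A of A d = e form a line of Sym₂, so 𝓑₀ ∪ 𝓑₁ contributes p, and
-- exactly one of 𝓑₂, 𝓑₃, 𝓑₄ contributes 1 (as d₀ = 0, d₁ = 0 or neither).  If d = 0, then
-- e ≠ 0, 𝓑₀ ∪ 𝓑₁ contributes 1 and exactly one of 𝓑₂, 𝓑₃, 𝓑₄ contributes p (as e₁ = 0,
-- e₀ = 0 or neither).  Distinct parameters give distinct blocks, so no block is counted twice.

open import Defs
open import Data.Nat using (ℕ; NonZero)
open import Data.Nat.Primality using (Prime)

module Sums where

  open import Data.Bool using (Bool; true; false; _∧_; T)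
  open import Data.Empty using (⊥-elim)
  open import Data.List using (List; []; _∷_; _++_; map; concatMap; filterᵇ; length)
  open import Data.List.Membership.Propositional using (_∈_; _∉_)
  open import Data.List.Relation.Unary.All using (All; []; _∷_)
  open import Data.List.Relation.Unary.AllPairs using (_∷_)
  open import Data.List.Relation.Unary.Any using (here; there)
  open import Data.List.Relation.Unary.Unique.Propositional using (Unique)
  open import Data.Nat using (suc; _+_; _*_)
  open import Data.Nat.Properties
    using (+-assoc; +-identityʳ; *-zeroʳ; *-distribˡ-+; *-comm; *-commutativeSemigroup)
  open import Algebra.Properties.CommutativeSemigroup *-commutativeSemigroup
    using () renaming (interchange to *-interchange)
  open import Function using (_⇔_; Equivalence)
  open import Relation.Binary.Definitions using (DecidableEquality)
  open import Relation.Binary.PropositionalEquality using (_≡_; refl; sym; trans; cong; cong₂)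
  open import Relation.Nullary using (Dec; yes; no; ¬_; does)
  open import Relation.Nullary.Decidable using (_×-dec_)

  bool→ℕ : Bool → ℕ
  bool→ℕ true  = 1
  bool→ℕ false = 0

  𝟙 : {P : Set} → Dec P → ℕ
  𝟙 d = bool→ℕ (does d)

  bool→ℕ-∧ : ∀ a b → bool→ℕ (a ∧ b) ≡ bool→ℕ a * bool→ℕ b
  bool→ℕ-∧ true  b = sym (+-identityʳ (bool→ℕ b))
  bool→ℕ-∧ false b = refl

  bool→ℕ-T⇔ : ∀ {b} {P : Set} → (T b ⇔ P) → (d : Dec P) → bool→ℕ b ≡ 𝟙 d
  bool→ℕ-T⇔ {true}  T⇔P (yes _) = refl
  bool→ℕ-T⇔ {true}  T⇔P (no ¬p) = ⊥-elim (¬p (Equivalence.to T⇔P _))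
  bool→ℕ-T⇔ {false} T⇔P (yes p) = ⊥-elim (Equivalence.from T⇔P p)
  bool→ℕ-T⇔ {false} T⇔P (no _)  = refl

  module _ {P Q : Set} where

    𝟙-cong : (d : Dec P) (e : Dec Q) → (P → Q) → (Q → P) → 𝟙 d ≡ 𝟙 e
    𝟙-cong (yes p) (yes q) f g = refl
    𝟙-cong (yes p) (no ¬q) f g = ⊥-elim (¬q (f p))
    𝟙-cong (no ¬p) (yes q) f g = ⊥-elim (¬p (g q))
    𝟙-cong (no ¬p) (no ¬q) f g = refl

    𝟙-× : (d : Dec P) (e : Dec Q) → 𝟙 (d ×-dec e) ≡ 𝟙 d * 𝟙 e
    𝟙-× (yes _) e = sym (+-identityʳ (𝟙 e))
    𝟙-× (no _)  e = refl

  𝟙-yes : {P : Set} (d : Dec P) → P → 𝟙 d ≡ 1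
  𝟙-yes (yes _) _ = refl
  𝟙-yes (no ¬p) p = ⊥-elim (¬p p)

  𝟙-no : {P : Set} (d : Dec P) → ¬ P → 𝟙 d ≡ 0
  𝟙-no (yes p) ¬p = ⊥-elim (¬p p)
  𝟙-no (no _)  _  = refl

  𝟙-×-interchange : ∀ {P Q R S : Set} (d : Dec P) (e : Dec Q) (d′ : Dec R) (e′ : Dec S) →
                    𝟙 (d ×-dec e) * 𝟙 (d′ ×-dec e′) ≡ (𝟙 d * 𝟙 d′) * (𝟙 e * 𝟙 e′)
  𝟙-×-interchange d e d′ e′ =
    trans (cong₂ _*_ (𝟙-× d e) (𝟙-× d′ e′)) (*-interchange (𝟙 d) (𝟙 e) (𝟙 d′) (𝟙 e′))

  +-cong₅ : ∀ {a₀ a₁ a₂ a₃ a₄ b₀ b₁ b₂ b₃ b₄} →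
            a₀ ≡ b₀ → a₁ ≡ b₁ → a₂ ≡ b₂ → a₃ ≡ b₃ → a₄ ≡ b₄ →
            a₀ + (a₁ + (a₂ + (a₃ + a₄))) ≡ b₀ + (b₁ + (b₂ + (b₃ + b₄)))
  +-cong₅ refl refl refl refl refl = refl

  ∑ : {A : Set} → List A → (A → ℕ) → ℕ
  ∑ []       f = 0
  ∑ (x ∷ xs) f = f x + ∑ xs f

  ∑-syntax : {A : Set} → List A → (A → ℕ) → ℕ
  ∑-syntax = ∑

  infix 5 ∑-syntax
  syntax ∑-syntax xs (λ x → e) = ∑[ x ∈ xs ] e

  module _ {A : Set} where

    ∑-++ : ∀ xs ys (f : A → ℕ) → ∑ (xs ++ ys) f ≡ ∑ xs f + ∑ ys f
    ∑-++ []       ys f = refl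
    ∑-++ (x ∷ xs) ys f = trans (cong (f x +_) (∑-++ xs ys f)) (sym (+-assoc (f x) _ _))

    ∑-map : ∀ {B : Set} (g : B → A) xs (f : A → ℕ) → ∑ (map g xs) f ≡ ∑[ x ∈ xs ] f (g x)
    ∑-map g []       f = refl
    ∑-map g (x ∷ xs) f = cong (f (g x) +_) (∑-map g xs f)

    ∑-concatMap : ∀ {B : Set} (g : B → List A) xs (f : A → ℕ) →
                  ∑ (concatMap g xs) f ≡ ∑[ x ∈ xs ] ∑ (g x) f
    ∑-concatMap g []       f = refl
    ∑-concatMap g (x ∷ xs) f = trans (∑-++ (g x) _ f) (cong (∑ (g x) f +_) (∑-concatMap g xs f))

    ∑-cong-∈ : ∀ xs {f g : A → ℕ} → (∀ {x} → x ∈ xs → f x ≡ g x) → ∑ xs f ≡ ∑ xs g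
    ∑-cong-∈ []       eq = refl
    ∑-cong-∈ (x ∷ xs) eq = cong₂ _+_ (eq (here refl)) (∑-cong-∈ xs (λ x∈ → eq (there x∈)))

    ∑-cong : ∀ xs {f g : A → ℕ} → (∀ x → f x ≡ g x) → ∑ xs f ≡ ∑ xs g
    ∑-cong xs eq = ∑-cong-∈ xs (λ {x} _ → eq x)

    ∑-zero : ∀ xs {f : A → ℕ} → (∀ x → f x ≡ 0) → ∑ xs f ≡ 0
    ∑-zero []       f≡0 = refl
    ∑-zero (x ∷ xs) f≡0 = cong₂ _+_ (f≡0 x) (∑-zero xs f≡0)

    ∑-const : ∀ (xs : List A) c → ∑[ _ ∈ xs ] c ≡ length xs * c
    ∑-const []       c = refl
    ∑-const (x ∷ xs) c = cong (c +_) (∑-const xs c)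

    ∑-*ˡ : ∀ xs c (f : A → ℕ) → ∑[ x ∈ xs ] c * f x ≡ c * ∑ xs f
    ∑-*ˡ []       c f = sym (*-zeroʳ c)
    ∑-*ˡ (x ∷ xs) c f = trans (cong (c * f x +_) (∑-*ˡ xs c f)) (sym (*-distribˡ-+ c (f x) _))

    ∑-*ʳ : ∀ xs c (f : A → ℕ) → ∑[ x ∈ xs ] f x * c ≡ ∑ xs f * c
    ∑-*ʳ xs c f = trans (∑-cong xs (λ x → *-comm (f x) c)) (trans (∑-*ˡ xs c f) (*-comm c _))

    length-filterᵇ : (P : A → Bool) (xs : List A) → length (filterᵇ P xs) ≡ ∑[ x ∈ xs ] bool→ℕ (P x)
    length-filterᵇ P []       = refl
    length-filterᵇ P (x ∷ xs) with P x
    ... | true  = cong suc (length-filterᵇ P xs)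
    ... | false = length-filterᵇ P xs

    module _ (_≟_ : DecidableEquality A) where

      ∑-δ-∉ : ∀ {xs t} (g : A → ℕ) → t ∉ xs → ∑[ x ∈ xs ] 𝟙 (x ≟ t) * g x ≡ 0
      ∑-δ-∉ {[]}         g t∉ = refl
      ∑-δ-∉ {x ∷ xs} {t} g t∉ with x ≟ t
      ... | yes refl = ⊥-elim (t∉ (here refl))
      ... | no _     = ∑-δ-∉ g (λ t∈ → t∉ (there t∈))

      ∑-δ : ∀ {xs t} (g : A → ℕ) → Unique xs → t ∈ xs → ∑[ x ∈ xs ] 𝟙 (x ≟ t) * g x ≡ g t
      ∑-δ {x ∷ xs} {t} g (x∉xs ∷ u) t∈ with x ≟ t | t∈
      ... | yes refl | _ =
        trans (cong₂ _+_ (+-identityʳ (g x)) (∑-δ-∉ g (All≢⇒∉ x∉xs))) (+-identityʳ (g x))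
        where
        All≢⇒∉ : ∀ {ys} → All (λ y → ¬ x ≡ y) ys → x ∉ ys
        All≢⇒∉ (x≢y ∷ _)  (here refl) = x≢y refl
        All≢⇒∉ (_ ∷ x∉ys) (there x∈)  = All≢⇒∉ x∉ys x∈
      ... | no x≢t | here refl  = ⊥-elim (x≢t refl)
      ... | no _   | there t∈xs = ∑-δ g u t∈xs

  ∑∑-* : ∀ {A B : Set} (xs : List A) (ys : List B) f g →
         ∑[ x ∈ xs ] ∑[ y ∈ ys ] f x * g y ≡ ∑ xs f * ∑ ys g
  ∑∑-* xs ys f g = trans (∑-cong xs (λ x → ∑-*ˡ ys (f x) g)) (∑-*ʳ xs (∑ ys g) f)

module Lists where

  open import Data.Bool using (Bool; true; false; T; if_then_else_)
  open import Data.Empty using (⊥-elim)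
  open import Data.List
    using (List; []; _∷_; _++_; map; foldr; concatMap; length; cartesianProductWith; deduplicate; filter)
  open import Data.List.Membership.Propositional using (_∈_)
  open import Data.List.Membership.Propositional.Properties
    using (∈-cartesianProductWith⁺; ∈-cartesianProductWith⁻)
  open import Data.List.Properties using (length-++; length-map; map-concatMap; concatMap-cong; map-∘; filter-all)
  import Data.List.Relation.Unary.All as All
  import Data.List.Relation.Unary.All.Properties as Allₚ
  open import Data.List.Relation.Unary.AllPairs as AllPairs using (AllPairs; []; _∷_)
  import Data.List.Relation.Unary.AllPairs.Properties as AllPairsₚ
  open import Data.List.Relation.Unary.Any as Any using (Any; here; there)
  open import Data.List.Relation.Unary.Any.Properties using (any⁺; any⁻)
  open import Data.List.Relation.Unary.Unique.Propositional using (Unique)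
  import Data.List.Relation.Unary.Unique.Propositional.Properties as Uniqueₚ
  open import Data.Nat using (_+_; _*_)
  open import Data.Product using (_×_; _,_; ∃₂)
  open import Function using (_∘_; _⇔_; mk⇔; Equivalence)
  open import Relation.Binary.Definitions using (DecidableEquality)
  open import Relation.Binary.PropositionalEquality using (_≡_; refl; sym; trans; cong; cong₂; subst)
  open import Relation.Nullary using (Dec; ¬_; ¬?)
  open import Relation.Nullary.Decidable using (toWitness; fromWitness)
  open Sums

  cong₃ : ∀ {A B C D : Set} (f : A → B → C → D) {a a′ b b′ c c′} →
          a ≡ a′ → b ≡ b′ → c ≡ c′ → f a b c ≡ f a′ b′ c′
  cong₃ f refl refl refl = refl

  foldr-find : ∀ {A : Set} (f : A → Bool) d xs → Any (T ∘ f) xs →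
               T (f (foldr (λ x r → if f x then x else r) d xs))
  foldr-find f d (x ∷ xs) _ with f x in fx≡
  foldr-find f d (x ∷ xs) _           | true  = subst T (sym fx≡) _
  foldr-find f d (x ∷ xs) (here fx)   | false = ⊥-elim (subst T fx≡ fx)
  foldr-find f d (x ∷ xs) (there fxs) | false = foldr-find f d xs fxs

  module _ {A B C : Set} where

    -- cartesianProductWith, in the shape in which elemsZp2, allPoints and the blocks are written
    grid : (A → B → C) → List A → List B → List C
    grid g xs ys = concatMap (λ x → map (g x) ys) xs

    grid≡cartesianProductWith : ∀ g xs ys → grid g xs ys ≡ cartesianProductWith g xs ys
    grid≡cartesianProductWith g []       ys = refl
    grid≡cartesianProductWith g (x ∷ xs) ys = cong (map (g x) ys ++_) (grid≡cartesianProductWith g xs ys)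

    ∈-grid⁺ : ∀ g {xs ys x y} → x ∈ xs → y ∈ ys → g x y ∈ grid g xs ys
    ∈-grid⁺ g {xs} {ys} x∈ y∈ =
      subst (g _ _ ∈_) (sym (grid≡cartesianProductWith g xs ys)) (∈-cartesianProductWith⁺ g x∈ y∈)

    ∈-grid⁻ : ∀ g xs ys {z} → z ∈ grid g xs ys → ∃₂ λ x y → z ≡ g x y
    ∈-grid⁻ g xs ys z∈
      with x , y , _ , _ , z≡ ←
             ∈-cartesianProductWith⁻ g xs ys (subst (_ ∈_) (grid≡cartesianProductWith g xs ys) z∈)
      = x , y , z≡

    grid-unique : ∀ g → (∀ {w x y z} → g w y ≡ g x z → w ≡ x × y ≡ z) →
                  ∀ {xs ys} → Unique xs → Unique ys → Unique (grid g xs ys)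
    grid-unique g g-injective {xs} {ys} uxs uys =
      subst Unique (sym (grid≡cartesianProductWith g xs ys)) (Uniqueₚ.cartesianProductWith⁺ g g-injective uxs uys)

    length-grid : ∀ g xs ys → length (grid g xs ys) ≡ length xs * length ys
    length-grid g []       ys = refl
    length-grid g (x ∷ xs) ys =
      trans (length-++ (map (g x) ys)) (cong₂ _+_ (length-map (g x) ys) (length-grid g xs ys))

    ∑-grid : ∀ g xs ys (f : C → ℕ) → ∑ (grid g xs ys) f ≡ ∑[ x ∈ xs ] ∑[ y ∈ ys ] f (g x y)
    ∑-grid g xs ys f = trans (∑-concatMap _ xs f) (∑-cong xs (λ x → ∑-map (g x) ys f))

  map-grid : ∀ {A B C D : Set} (h : C → D) (g : A → B → C) xs ys →
             map h (grid g xs ys) ≡ grid (λ x y → h (g x y)) xs ys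
  map-grid h g xs ys = trans (map-concatMap h _ xs) (concatMap-cong (λ x → sym (map-∘ ys)) xs)

  ∑-cube : ∀ {A B C D : Set} (g : A → B → C → D) xs ys zs (f : D → ℕ) →
           ∑ (concatMap (λ x → grid (g x) ys zs) xs) f ≡ ∑[ x ∈ xs ] ∑[ y ∈ ys ] ∑[ z ∈ zs ] f (g x y z)
  ∑-cube g xs ys zs f = trans (∑-concatMap _ xs f) (∑-cong xs (λ x → ∑-grid (g x) ys zs f))

  Unique-concatMap⁺ : ∀ {A B : Set} (key : B → A) (f : A → List B) → (∀ {x z} → z ∈ f x → key z ≡ x) →
                      ∀ {xs} → Unique xs → (∀ x → Unique (f x)) → Unique (concatMap f xs)
  Unique-concatMap⁺ key f key-f uxs uf = Uniqueₚ.concat⁺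
    (Allₚ.map⁺ (All.tabulate (λ {x} _ → uf x)))
    (AllPairsₚ.map⁺ {f = f} (AllPairs.map (λ x≢y {_} (z∈fx , z∈fy) → x≢y (trans (sym (key-f z∈fx)) (key-f z∈fy)))
                                          uxs))

  deduplicate-id : ∀ {A : Set} {R : A → A → Set} (R? : ∀ x y → Dec (R x y)) {xs} →
                   AllPairs (λ x y → ¬ R x y) xs → deduplicate R? xs ≡ xs
  deduplicate-id R? []                  = refl
  deduplicate-id R? {x ∷ _} (¬Rx ∷ ¬R) =
    cong (x ∷_) (trans (cong (filter (¬? ∘ R? x)) (deduplicate-id R? ¬R)) (filter-all (¬? ∘ R? x) ¬Rx))

  module _ {P : Set} (_≟_ : DecidableEquality P) (pts : List P) where

    card-unique : ∀ {B} → Unique B → card _≟_ pts B ≡ length B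
    card-unique u = cong length (deduplicate-id _≟_ u)

    T-memᵇ⇔∈ : ∀ {x B} → T (memᵇ _≟_ pts x B) ⇔ x ∈ B
    T-memᵇ⇔∈ = mk⇔ (Any.map toWitness ∘ any⁻ _ _) (any⁺ _ ∘ Any.map fromWitness)

    T-sameSetᵇ⇒⇔ : (∀ x → x ∈ pts) → ∀ {B C} → T (sameSetᵇ _≟_ pts B C) → ∀ {x} → x ∈ B ⇔ x ∈ C
    T-sameSetᵇ⇒⇔ complete {B} {C} same {x}
      with memᵇ _≟_ pts x B in x∈?B | memᵇ _≟_ pts x C in x∈?C | All.lookup (Allₚ.all⁺ _ pts same) (complete x)
    ... | true  | true  | _ = mk⇔ (λ _ → Equivalence.to T-memᵇ⇔∈ (subst T (sym x∈?C) _))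
                                 (λ _ → Equivalence.to T-memᵇ⇔∈ (subst T (sym x∈?B) _))
    ... | false | false | _ = mk⇔ (λ x∈B → ⊥-elim (subst T x∈?B (Equivalence.from T-memᵇ⇔∈ x∈B)))
                                 (λ x∈C → ⊥-elim (subst T x∈?C (Equivalence.from T-memᵇ⇔∈ x∈C)))

module ℤₚ (p : ℕ) .{{_ : NonZero p}} where

  open import Algebra.Bundles using (CommutativeRing)
  open import Algebra.Structures using (IsCommutativeRing)
  import Algebra.Properties.AbelianGroup as AbelianGroupProperties
  import Algebra.Properties.CommutativeSemigroup as CommutativeSemigroupProperties
  import Algebra.Properties.Ring as RingProperties
  open import Data.Fin using (toℕ)
  open import Data.Fin.Properties using (toℕ-injective; toℕ-fromℕ<; toℕ<n)
  open import Data.Nat as ℕ using (ℕ; NonZero)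
  import Data.Nat.Properties as ℕ
  open import Data.Nat.DivMod using (_mod_; _%_; %-distribˡ-+; %-distribˡ-*; m%n%n≡m%n; m<n⇒m%n≡m; m*n%n≡0)
  open import Data.Product using (_×_; _,_; proj₁; proj₂)
  open import Level using (0ℓ)
  open import Relation.Binary.PropositionalEquality
    using (_≡_; refl; sym; trans; cong; cong₂; isEquivalence; module ≡-Reasoning)
  open ≡-Reasoning

  infixl 6 _+_ _-_
  infixl 7 _*_
  infix  8 -_

  _+_ _*_ _-_ : Zp p → Zp p → Zp p
  _+_ = _+p_ p
  _*_ = _*p_ p
  a - b = a + negp p b

  -_ : Zp p → Zp p
  -_ = negp p

  -- ℤₚ is the image of the reduction map [_] : ℕ → ℤₚ, which respects + and *; each ring law
  -- is transported from ℕ by moving [_] outwards.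
  [_] : ℕ → Zp p
  [ n ] = n mod p

  0# 1# : Zp p
  0# = [ 0 ]
  1# = [ 1 ]

  toℕ-[] : ∀ n → toℕ [ n ] ≡ n % p
  toℕ-[] n = toℕ-fromℕ< _

  []-cong : ∀ {m n} → m % p ≡ n % p → [ m ] ≡ [ n ]
  []-cong eq = toℕ-injective (trans (toℕ-[] _) (trans eq (sym (toℕ-[] _))))

  []-toℕ : ∀ a → [ toℕ a ] ≡ a
  []-toℕ a = toℕ-injective (trans (toℕ-[] _) (m<n⇒m%n≡m (toℕ<n a)))

  []-toℕ-+ : ∀ m n → [ toℕ [ m ] ℕ.+ n ] ≡ [ m ℕ.+ n ]
  []-toℕ-+ m n = []-cong (begin
    (toℕ [ m ] ℕ.+ n) % p         ≡⟨ cong (λ k → (k ℕ.+ n) % p) (toℕ-[] m) ⟩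
    (m % p ℕ.+ n) % p             ≡⟨ %-distribˡ-+ (m % p) n p ⟩
    (m % p % p ℕ.+ n % p) % p     ≡⟨ cong (λ k → (k ℕ.+ n % p) % p) (m%n%n≡m%n m p) ⟩
    (m % p ℕ.+ n % p) % p         ≡⟨ %-distribˡ-+ m n p ⟨
    (m ℕ.+ n) % p                 ∎)

  []-+-toℕ : ∀ m n → [ m ℕ.+ toℕ [ n ] ] ≡ [ m ℕ.+ n ]
  []-+-toℕ m n = trans (cong [_] (ℕ.+-comm m _)) (trans ([]-toℕ-+ n m) (cong [_] (ℕ.+-comm n m)))

  []-toℕ-* : ∀ m n → [ toℕ [ m ] ℕ.* n ] ≡ [ m ℕ.* n ]
  []-toℕ-* m n = []-cong (begin
    (toℕ [ m ] ℕ.* n) % p         ≡⟨ cong (λ k → (k ℕ.* n) % p) (toℕ-[] m) ⟩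
    (m % p ℕ.* n) % p             ≡⟨ %-distribˡ-* (m % p) n p ⟩
    (m % p % p ℕ.* (n % p)) % p   ≡⟨ cong (λ k → (k ℕ.* (n % p)) % p) (m%n%n≡m%n m p) ⟩
    (m % p ℕ.* (n % p)) % p       ≡⟨ %-distribˡ-* m n p ⟨
    (m ℕ.* n) % p                 ∎)

  []-*-toℕ : ∀ m n → [ m ℕ.* toℕ [ n ] ] ≡ [ m ℕ.* n ]
  []-*-toℕ m n = trans (cong [_] (ℕ.*-comm m _)) (trans ([]-toℕ-* n m) (cong [_] (ℕ.*-comm n m)))

  []-+ : ∀ m n → [ m ℕ.+ n ] ≡ [ m ] + [ n ]
  []-+ m n = sym (trans ([]-toℕ-+ m _) ([]-+-toℕ m n))

  []-* : ∀ m n → [ m ℕ.* n ] ≡ [ m ] * [ n ]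
  []-* m n = sym (trans ([]-toℕ-* m _) ([]-*-toℕ m n))

  []-multiple : ∀ k → [ k ℕ.* p ] ≡ 0#
  []-multiple k = []-cong (trans (m*n%n≡0 k p) (sym (m<n⇒m%n≡m (ℕ.>-nonZero⁻¹ p))))

  +-assoc : ∀ a b c → (a + b) + c ≡ a + (b + c)
  +-assoc a b c = trans ([]-toℕ-+ (toℕ a ℕ.+ toℕ b) (toℕ c))
    (trans (cong [_] (ℕ.+-assoc (toℕ a) (toℕ b) (toℕ c))) (sym ([]-+-toℕ (toℕ a) (toℕ b ℕ.+ toℕ c))))

  *-assoc : ∀ a b c → (a * b) * c ≡ a * (b * c)
  *-assoc a b c = trans ([]-toℕ-* (toℕ a ℕ.* toℕ b) (toℕ c))
    (trans (cong [_] (ℕ.*-assoc (toℕ a) (toℕ b) (toℕ c))) (sym ([]-*-toℕ (toℕ a) (toℕ b ℕ.* toℕ c))))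

  +-comm : ∀ a b → a + b ≡ b + a
  +-comm a b = cong [_] (ℕ.+-comm (toℕ a) (toℕ b))

  *-comm : ∀ a b → a * b ≡ b * a
  *-comm a b = cong [_] (ℕ.*-comm (toℕ a) (toℕ b))

  +-identityˡ : ∀ a → 0# + a ≡ a
  +-identityˡ a = trans ([]-toℕ-+ 0 (toℕ a)) ([]-toℕ a)

  +-identityʳ : ∀ a → a + 0# ≡ a
  +-identityʳ a = trans (+-comm a 0#) (+-identityˡ a)

  *-identityˡ : ∀ a → 1# * a ≡ a
  *-identityˡ a = trans ([]-toℕ-* 1 (toℕ a)) (trans (cong [_] (ℕ.*-identityˡ (toℕ a))) ([]-toℕ a))

  *-identityʳ : ∀ a → a * 1# ≡ a
  *-identityʳ a = trans (*-comm a 1#) (*-identityˡ a)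

  -‿inverseˡ : ∀ a → - a + a ≡ 0#
  -‿inverseˡ a = trans ([]-toℕ-+ (p ℕ.∸ toℕ a) (toℕ a))
    (trans (cong [_] (ℕ.m∸n+n≡m (ℕ.<⇒≤ (toℕ<n a)))) (trans (cong [_] (sym (ℕ.*-identityˡ p))) ([]-multiple 1)))

  -‿inverseʳ : ∀ a → a + - a ≡ 0#
  -‿inverseʳ a = trans (+-comm a (- a)) (-‿inverseˡ a)

  *-distribˡ-+ : ∀ a b c → a * (b + c) ≡ a * b + a * c
  *-distribˡ-+ a b c = begin
    [ toℕ a ℕ.* toℕ (b + c) ]                    ≡⟨ []-*-toℕ (toℕ a) _ ⟩
    [ toℕ a ℕ.* (toℕ b ℕ.+ toℕ c) ]              ≡⟨ cong [_] (ℕ.*-distribˡ-+ (toℕ a) (toℕ b) (toℕ c)) ⟩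
    [ toℕ a ℕ.* toℕ b ℕ.+ toℕ a ℕ.* toℕ c ]      ≡⟨ []-toℕ-+ _ _ ⟨
    [ toℕ (a * b) ℕ.+ toℕ a ℕ.* toℕ c ]          ≡⟨ []-+-toℕ _ _ ⟨
    a * b + a * c                                ∎

  *-distribʳ-+ : ∀ a b c → (b + c) * a ≡ b * a + c * a
  *-distribʳ-+ a b c =
    trans (*-comm (b + c) a) (trans (*-distribˡ-+ a b c) (cong₂ _+_ (*-comm a b) (*-comm a c)))

  isCommutativeRing : IsCommutativeRing _≡_ _+_ _*_ -_ 0# 1#
  isCommutativeRing = record
    { isRing = record
      { +-isAbelianGroup = record
        { isGroup = record
          { isMonoid = record
            { isSemigroup = record
              { isMagma = record { isEquivalence = isEquivalence ; ∙-cong = cong₂ _+_ }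
              ; assoc = +-assoc }
            ; identity = +-identityˡ , +-identityʳ }
          ; inverse = -‿inverseˡ , -‿inverseʳ
          ; ⁻¹-cong = cong (negp p) }
        ; comm = +-comm }
      ; *-cong = cong₂ _*_
      ; *-assoc = *-assoc
      ; *-identity = *-identityˡ , *-identityʳ
      ; distrib = *-distribˡ-+ , *-distribʳ-+ }
    ; *-comm = *-comm }

  commutativeRing : CommutativeRing 0ℓ 0ℓ
  commutativeRing = record { isCommutativeRing = isCommutativeRing }

  open CommutativeRing commutativeRing public using (zeroʳ)
  open CommutativeRing commutativeRing using (+-abelianGroup; +-commutativeSemigroup; ring)
  open AbelianGroupProperties +-abelianGroup public using (xyx⁻¹≈y; x∙y⁻¹≈ε⇒x≈y; x≈y⇒x∙y⁻¹≈ε)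
  open AbelianGroupProperties +-abelianGroup using (⁻¹-∙-comm; ∙-cancelʳ)
  open CommutativeSemigroupProperties +-commutativeSemigroup using (interchange; x∙yz≈y∙xz)
  open RingProperties ring public using (-‿distribˡ-*; -‿distribʳ-*; -‿involutive; x[y-z]≈xy-xz)

  y+[x-y]≡x : ∀ x y → y + (x - y) ≡ x
  y+[x-y]≡x x y = trans (sym (+-assoc y x (- y))) (xyx⁻¹≈y y x)

  x≡y+z⇒z≡x-y : ∀ {x y z} → x ≡ y + z → z ≡ x - y
  x≡y+z⇒z≡x-y {y = y} {z} refl = sym (xyx⁻¹≈y y z)

  z≡x-y⇒x≡y+z : ∀ {x y z} → z ≡ x - y → x ≡ y + z
  z≡x-y⇒x≡y+z {x} {y} refl = sym (y+[x-y]≡x x y)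

  [a+b]-[c+d]≡[a-c]+[b-d] : ∀ a b c d → (a + b) - (c + d) ≡ (a - c) + (b - d)
  [a+b]-[c+d]≡[a-c]+[b-d] a b c d =
    trans (cong ((a + b) +_) (sym (⁻¹-∙-comm c d))) (interchange a b (- c) (- d))

  x≡u+[y-v]⇒u-v≡x-y : ∀ {x y u v} → x ≡ u + (y - v) → u - v ≡ x - y
  x≡u+[y-v]⇒u-v≡x-y {x} {y} {u} {v} x≡ = sym (begin
    x - y                    ≡⟨ cong (_- y) x≡ ⟩
    u + (y - v) - y          ≡⟨ cong (_- y) (x∙yz≈y∙xz u y (- v)) ⟩
    y + (u - v) - y          ≡⟨ xyx⁻¹≈y y (u - v) ⟩
    u - v                    ∎)

  u-v≡x-y⇒x≡u+[y-v] : ∀ {x y u v} → u - v ≡ x - y → x ≡ u + (y - v)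
  u-v≡x-y⇒x≡u+[y-v] {x} {y} {u} {v} eq = begin
    x                        ≡⟨ y+[x-y]≡x x y ⟨
    y + (x - y)              ≡⟨ cong (y +_) eq ⟨
    y + (u - v)              ≡⟨ x∙yz≈y∙xz y u (- v) ⟩
    u + (y - v)              ∎

  +-cancelʳ : ∀ {x y} z → x + z ≡ y + z → x ≡ y
  +-cancelʳ {x} {y} z = ∙-cancelʳ z x y

  x+y*0≡x : ∀ x y → x + y * 0# ≡ x
  x+y*0≡x x y = trans (cong (x +_) (zeroʳ y)) (+-identityʳ x)

  x*0+y≡y : ∀ x y → x * 0# + y ≡ y
  x*0+y≡y x y = trans (cong (_+ y) (zeroʳ x)) (+-identityˡ y)

  affine-injective : ∀ {x y x′ y′} → x * 0# + y ≡ x′ * 0# + y′ → x * 1# + y ≡ x′ * 1# + y′ → x ≡ x′ × y ≡ y′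
  affine-injective {x} {y} {x′} {y′} at0 at1 = +-cancelʳ y x+y≡x′+y , y≡y′
    where
    y≡y′ : y ≡ y′
    y≡y′ = trans (sym (x*0+y≡y x y)) (trans at0 (x*0+y≡y x′ y′))
    x+y≡x′+y : x + y ≡ x′ + y
    x+y≡x′+y = begin
      x + y          ≡⟨ cong (_+ y) (*-identityʳ x) ⟨
      x * 1# + y     ≡⟨ at1 ⟩
      x′ * 1# + y′   ≡⟨ cong₂ _+_ (*-identityʳ x′) (sym y≡y′) ⟩
      x′ + y         ∎

  affine₂-injective : ∀ {x y z x′ y′ z′} →
    x * 0# + y * 0# + z ≡ x′ * 0# + y′ * 0# + z′ →
    x * 1# + y * 0# + z ≡ x′ * 1# + y′ * 0# + z′ →
    x * 0# + y * 1# + z ≡ x′ * 0# + y′ * 1# + z′ → x ≡ x′ × y ≡ y′ × z ≡ z′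
  affine₂-injective {x} {y} {z} {x′} {y′} {z′} at00 at10 at01 = proj₁ xz , proj₁ yz , proj₂ xz
    where
    drop-y : ∀ u → x * u + y * 0# + z ≡ x′ * u + y′ * 0# + z′ → x * u + z ≡ x′ * u + z′
    drop-y u eq = trans (cong (_+ z) (sym (x+y*0≡x (x * u) y))) (trans eq (cong (_+ z′) (x+y*0≡x (x′ * u) y′)))
    drop-x : ∀ v → x * 0# + y * v + z ≡ x′ * 0# + y′ * v + z′ → y * v + z ≡ y′ * v + z′
    drop-x v eq = trans (sym (trans (+-assoc (x * 0#) (y * v) z) (x*0+y≡y x (y * v + z))))
                        (trans eq (trans (+-assoc (x′ * 0#) (y′ * v) z′) (x*0+y≡y x′ (y′ * v + z′))))
    xz = affine-injective {x} {z} {x′} {z′} (drop-y 0# at00) (drop-y 1# at10)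
    yz = affine-injective {y} {z} {y′} {z′} (drop-x 0# at00) (drop-x 1# at01)

  linear-difference : ∀ a b x′ y′ x y → (a * x′ + b * y′) - (a * x + b * y) ≡ a * (x′ - x) + b * (y′ - y)
  linear-difference a b x′ y′ x y = trans ([a+b]-[c+d]≡[a-c]+[b-d] (a * x′) (b * y′) (a * x) (b * y))
    (sym (cong₂ _+_ (x[y-z]≈xy-xz a x′ x) (x[y-z]≈xy-xz b y′ y)))

module 𝔽ₚ (p : ℕ) .{{_ : NonZero p}} (p-prime : Prime p) where

  open import Data.Bool using (Bool; T; true; false; not)
  open import Data.Fin using (toℕ; _≟_)
  open import Data.Fin.Properties using (toℕ-injective; toℕ<n)
  open import Data.List using (List; allFin; length)
  open import Data.List.Membership.Propositional using (_∈_; lose)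
  open import Data.List.Membership.Propositional.Properties using (∈-allFin; ∈-filter⁺; ∈-filter⁻)
  open import Data.List.Properties using (length-tabulate)
  import Data.List.Relation.Unary.Unique.Propositional.Properties as Uniqueₚ
  open import Data.Nat as ℕ using (ℕ; NonZero; _≡ᵇ_; nonTrivial⇒n>1; ≢-nonZero; >-nonZero⁻¹)
  open import Data.Nat.Coprimality using (prime⇒coprime; coprime-Bézout)
  open import Data.Nat.DivMod using (m<n⇒m%n≡m)
  open import Data.Nat.GCD using (module Bézout)
  open import Data.Nat.Primality using (Prime; prime⇒nonTrivial)
  import Data.Nat.Properties as ℕ
  open import Data.Bool.Properties using (T?)
  open import Data.Product using (∃; _,_; proj₂)
  open import Function using (id; _∘_; _⇔_; mk⇔; Equivalence)
  open import Relation.Binary.PropositionalEquality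
    using (_≡_; _≢_; refl; sym; trans; cong; subst; module ≡-Reasoning)
  open Sums
  open Lists using (foldr-find)
  open ℤₚ p public
  open ≡-Reasoning

  toℕ-0# : toℕ 0# ≡ 0
  toℕ-0# = trans (toℕ-[] 0) (m<n⇒m%n≡m (>-nonZero⁻¹ p))

  toℕ-1# : toℕ 1# ≡ 1
  toℕ-1# = trans (toℕ-[] 1) (m<n⇒m%n≡m (nonTrivial⇒n>1 p {{prime⇒nonTrivial p-prime}}))

  1≢0 : 1# ≢ 0#
  1≢0 eq with trans (sym toℕ-1#) (trans (cong toℕ eq) toℕ-0#)
  ... | ()

  toℕ≡0⇒≡0 : ∀ {a} → toℕ a ≡ 0 → a ≡ 0#
  toℕ≡0⇒≡0 eq = toℕ-injective (trans eq (sym toℕ-0#))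

  []-*-toℕ≡[]* : ∀ y a → [ y ℕ.* toℕ a ] ≡ [ y ] * a
  []-*-toℕ≡[]* y a = trans ([]-* y (toℕ a)) (cong ([ y ] *_) ([]-toℕ a))

  -- Bézout gives y·a ≡ ±1 (mod p), so ±y is an inverse of a.
  *-inverse-exists : ∀ {a} → a ≢ 0# → ∃ λ x → a * x ≡ 1#
  *-inverse-exists {a} a≢0
    with coprime-Bézout (prime⇒coprime p-prime {{≢-nonZero (a≢0 ∘ toℕ≡0⇒≡0)}} (toℕ<n a))
  ... | Bézout.-+ x y eq = [ y ] , (begin
    a * [ y ]                ≡⟨ *-comm a [ y ] ⟩
    [ y ] * a                ≡⟨ []-*-toℕ≡[]* y a ⟨
    [ y ℕ.* toℕ a ]          ≡⟨ cong [_] eq ⟨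
    [ 1 ℕ.+ x ℕ.* p ]        ≡⟨ []-+ 1 (x ℕ.* p) ⟩
    1# + [ x ℕ.* p ]         ≡⟨ cong (1# +_) ([]-multiple x) ⟩
    1# + 0#                  ≡⟨ +-identityʳ 1# ⟩
    1#                       ∎)
  ... | Bézout.+- x y eq = - [ y ] , (begin
    a * - [ y ]              ≡⟨ -‿distribʳ-* a [ y ] ⟨
    - (a * [ y ])            ≡⟨ cong -_ (x≡y+z⇒z≡x-y {0#} {1#} 0≡1+a[y]) ⟩
    - (0# - 1#)              ≡⟨ cong -_ (+-identityˡ (- 1#)) ⟩
    - (- 1#)                 ≡⟨ -‿involutive 1# ⟩
    1#                       ∎)
    where
    0≡1+a[y] : 0# ≡ 1# + a * [ y ]
    0≡1+a[y] = begin
      0#                     ≡⟨ []-multiple x ⟨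
      [ x ℕ.* p ]            ≡⟨ cong [_] eq ⟨
      [ 1 ℕ.+ y ℕ.* toℕ a ]  ≡⟨ []-+ 1 _ ⟩
      1# + [ y ℕ.* toℕ a ]   ≡⟨ cong (1# +_) (trans ([]-*-toℕ≡[]* y a) (*-comm [ y ] a)) ⟩
      1# + a * [ y ]         ∎

  _⁻¹ : Zp p → Zp p
  _⁻¹ = invp p

  *-inverseʳ : ∀ {a} → a ≢ 0# → a * a ⁻¹ ≡ 1#
  *-inverseʳ {a} a≢0 = toℕ-injective (trans (ℕ.≡ᵇ⇒≡ _ 1 a*a⁻¹≡ᵇ1) (sym toℕ-1#))
    where
    a*a⁻¹≡ᵇ1 : T (toℕ (a * a ⁻¹) ≡ᵇ 1)
    a*a⁻¹≡ᵇ1 with x , a*x≡1 ← *-inverse-exists a≢0 =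
      foldr-find (λ x → toℕ (a * x) ≡ᵇ 1) _ (allFin p)
        (lose (∈-allFin x) (ℕ.≡⇒≡ᵇ _ 1 (trans (cong toℕ a*x≡1) toℕ-1#)))

  *-inverseˡ : ∀ {a} → a ≢ 0# → a ⁻¹ * a ≡ 1#
  *-inverseˡ {a} a≢0 = trans (*-comm (a ⁻¹) a) (*-inverseʳ a≢0)

  x*[x⁻¹*y]≡y : ∀ {x} y → x ≢ 0# → x * (x ⁻¹ * y) ≡ y
  x*[x⁻¹*y]≡y {x} y x≢0 =
    trans (sym (*-assoc x (x ⁻¹) y)) (trans (cong (_* y) (*-inverseʳ x≢0)) (*-identityˡ y))

  x⁻¹*[x*y]≡y : ∀ {x} y → x ≢ 0# → x ⁻¹ * (x * y) ≡ y
  x⁻¹*[x*y]≡y {x} y x≢0 =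
    trans (sym (*-assoc (x ⁻¹) x y)) (trans (cong (_* y) (*-inverseˡ x≢0)) (*-identityˡ y))

  x*y≡z⇒x≡z*y⁻¹ : ∀ {x y z} → y ≢ 0# → x * y ≡ z → x ≡ z * y ⁻¹
  x*y≡z⇒x≡z*y⁻¹ {x} {y} {z} y≢0 refl = begin
    x                        ≡⟨ x⁻¹*[x*y]≡y x y≢0 ⟨
    y ⁻¹ * (y * x)           ≡⟨ *-comm (y ⁻¹) (y * x) ⟩
    y * x * y ⁻¹             ≡⟨ cong (_* y ⁻¹) (*-comm y x) ⟩
    x * y * y ⁻¹             ∎

  x≡z*y⁻¹⇒x*y≡z : ∀ {x y z} → y ≢ 0# → x ≡ z * y ⁻¹ → x * y ≡ z
  x≡z*y⁻¹⇒x*y≡z {y = y} {z} y≢0 refl = begin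
    z * y ⁻¹ * y             ≡⟨ *-comm (z * y ⁻¹) y ⟩
    y * (z * y ⁻¹)           ≡⟨ cong (y *_) (*-comm z (y ⁻¹)) ⟩
    y * (y ⁻¹ * z)           ≡⟨ x*[x⁻¹*y]≡y z y≢0 ⟩
    z                        ∎

  x*y≢0 : ∀ {x y} → x ≢ 0# → y ≢ 0# → x * y ≢ 0#
  x*y≢0 {x} {y} x≢0 y≢0 xy≡0 = y≢0 (begin
    y                        ≡⟨ x⁻¹*[x*y]≡y y x≢0 ⟨
    x ⁻¹ * (x * y)           ≡⟨ cong (x ⁻¹ *_) xy≡0 ⟩
    x ⁻¹ * 0#                ≡⟨ zeroʳ (x ⁻¹) ⟩
    0#                       ∎)

  x⁻¹≢0 : ∀ {x} → x ≢ 0# → x ⁻¹ ≢ 0#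
  x⁻¹≢0 {x} x≢0 x⁻¹≡0 = 1≢0 (trans (sym (*-inverseʳ x≢0)) (trans (cong (x *_) x⁻¹≡0) (zeroʳ x)))

  -x≢0 : ∀ {x} → x ≢ 0# → - x ≢ 0#
  -x≢0 {x} x≢0 -x≡0 = x≢0 (sym (x∙y⁻¹≈ε⇒x≈y 0# x (trans (+-identityˡ (- x)) -x≡0)))

  -x⁻¹*y≡z⇒x≡-y*z⁻¹ : ∀ {x y z} → x ≢ 0# → z ≢ 0# → - x ⁻¹ * y ≡ z → x ≡ - y * z ⁻¹
  -x⁻¹*y≡z⇒x≡-y*z⁻¹ {x} {y} {z} x≢0 z≢0 eq = x*y≡z⇒x≡z*y⁻¹ {x} {z} { - y} z≢0 (begin
    x * z                    ≡⟨ cong (x *_) eq ⟨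
    x * (- x ⁻¹ * y)         ≡⟨ cong (x *_) (-‿distribˡ-* (x ⁻¹) y) ⟨
    x * - (x ⁻¹ * y)         ≡⟨ -‿distribʳ-* x (x ⁻¹ * y) ⟨
    - (x * (x ⁻¹ * y))       ≡⟨ cong -_ (x*[x⁻¹*y]≡y y x≢0) ⟩
    - y                      ∎)

  x≡-y*z⁻¹⇒-x⁻¹*y≡z : ∀ {x y z} → x ≢ 0# → z ≢ 0# → x ≡ - y * z ⁻¹ → - x ⁻¹ * y ≡ z
  x≡-y*z⁻¹⇒-x⁻¹*y≡z {x} {y} {z} x≢0 z≢0 eq = begin
    - x ⁻¹ * y               ≡⟨ -‿distribˡ-* (x ⁻¹) y ⟨
    - (x ⁻¹ * y)             ≡⟨ cong (λ w → - (x ⁻¹ * w)) y≡-[x*z] ⟩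
    - (x ⁻¹ * - (x * z))     ≡⟨ cong -_ (-‿distribʳ-* (x ⁻¹) (x * z)) ⟨
    - - (x ⁻¹ * (x * z))     ≡⟨ -‿involutive _ ⟩
    x ⁻¹ * (x * z)           ≡⟨ x⁻¹*[x*y]≡y z x≢0 ⟩
    z                        ∎
    where
    y≡-[x*z] : y ≡ - (x * z)
    y≡-[x*z] = trans (sym (-‿involutive y)) (cong -_ (sym (x≡z*y⁻¹⇒x*y≡z {x} {z} { - y} z≢0 eq)))

  δ : Zp p → Zp p → ℕ
  δ a b = 𝟙 (a ≟ b)

  δ-sym : ∀ a b → δ a b ≡ δ b a
  δ-sym a b = 𝟙-cong (a ≟ b) (b ≟ a) sym sym

  δ-≡ : ∀ {a b} → a ≡ b → δ a b ≡ 1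
  δ-≡ {a} {b} = 𝟙-yes (a ≟ b)

  δ-≢ : ∀ {a b} → a ≢ b → δ a b ≡ 0
  δ-≢ {a} {b} = 𝟙-no (a ≟ b)

  U NZ : List (Zp p)
  U  = elemsZp p
  NZ = nonzeroZp p

  ∑U-const : ∀ k → ∑[ _ ∈ U ] k ≡ p ℕ.* k
  ∑U-const k = trans (∑-const U k) (cong (ℕ._* k) (length-tabulate {n = p} id))

  ∑U-δ : ∀ t (g : Zp p → ℕ) → ∑[ x ∈ U ] δ x t ℕ.* g x ≡ g t
  ∑U-δ t g = ∑-δ _≟_ g (Uniqueₚ.allFin⁺ p) (∈-allFin t)

  ∑U-δδ : ∀ u v → ∑[ c ∈ U ] δ u c ℕ.* δ v c ≡ δ u v
  ∑U-δδ u v = begin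
    ∑[ c ∈ U ] δ u c ℕ.* δ v c   ≡⟨ ∑-cong U (λ c → cong (ℕ._* δ v c) (δ-sym u c)) ⟩
    ∑[ c ∈ U ] δ c u ℕ.* δ v c   ≡⟨ ∑U-δ u (δ v) ⟩
    δ v u                        ≡⟨ δ-sym v u ⟩
    δ u v                        ∎

  ∑U-translation : ∀ u v u′ v′ → ∑[ b ∈ U ] δ v (u + b) ℕ.* δ v′ (u′ + b) ≡ δ (u′ - u) (v′ - v)
  ∑U-translation u v u′ v′ = begin
    ∑[ b ∈ U ] δ v (u + b) ℕ.* δ v′ (u′ + b)
      ≡⟨ ∑-cong U (λ b → cong (ℕ._* δ v′ (u′ + b))
           (𝟙-cong (v ≟ u + b) (b ≟ v - u) (x≡y+z⇒z≡x-y {v} {u}) (z≡x-y⇒x≡y+z {v} {u}))) ⟩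
    ∑[ b ∈ U ] δ b (v - u) ℕ.* δ v′ (u′ + b)
      ≡⟨ ∑U-δ (v - u) (λ b → δ v′ (u′ + b)) ⟩
    δ v′ (u′ + (v - u))
      ≡⟨ 𝟙-cong (v′ ≟ u′ + (v - u)) (u′ - u ≟ v′ - v)
           (x≡u+[y-v]⇒u-v≡x-y {v′} {v} {u′} {u}) (u-v≡x-y⇒x≡u+[y-v] {v′} {v} {u′} {u}) ⟩
    δ (u′ - u) (v′ - v)          ∎

  ∑U-δ-linear : ∀ {d} e → d ≢ 0# → ∑[ a ∈ U ] δ (a * d) e ≡ 1
  ∑U-δ-linear {d} e d≢0 = begin
    ∑[ a ∈ U ] δ (a * d) e
      ≡⟨ ∑-cong U (λ a → 𝟙-cong (a * d ≟ e) (a ≟ e * d ⁻¹) (x*y≡z⇒x≡z*y⁻¹ d≢0) (x≡z*y⁻¹⇒x*y≡z d≢0)) ⟩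
    ∑[ a ∈ U ] δ a (e * d ⁻¹)
      ≡⟨ ∑-cong U (λ a → sym (ℕ.*-identityʳ (δ a (e * d ⁻¹)))) ⟩
    ∑[ a ∈ U ] δ a (e * d ⁻¹) ℕ.* 1
      ≡⟨ ∑U-δ (e * d ⁻¹) (λ _ → 1) ⟩
    1 ∎

  ∑U-δ-affine : ∀ c {d} e → d ≢ 0# → ∑[ a ∈ U ] δ (c + a * d) e ≡ 1
  ∑U-δ-affine c {d} e d≢0 = trans
    (∑-cong U (λ a → 𝟙-cong (c + a * d ≟ e) (a * d ≟ e - c) (x≡y+z⇒z≡x-y ∘ sym) (sym ∘ z≡x-y⇒x≡y+z)))
    (∑U-δ-linear (e - c) d≢0)

  ∈NZ⇔≢0 : ∀ {x} → x ∈ NZ ⇔ x ≢ 0#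
  ∈NZ⇔≢0 {x} = mk⇔ (λ x∈ → ≢0 (proj₂ (∈-filter⁻ (T? ∘ nonzeroᵇ) {xs = U} x∈)))
                   (λ x≢0 → ∈-filter⁺ (T? ∘ nonzeroᵇ) (∈-allFin x) (nonzero x≢0))
    where
    nonzeroᵇ : Zp p → Bool
    nonzeroᵇ y = not (toℕ y ≡ᵇ 0)
    ≢0 : T (nonzeroᵇ x) → x ≢ 0#
    ≢0 t refl rewrite toℕ-0# = t
    nonzero : x ≢ 0# → T (nonzeroᵇ x)
    nonzero x≢0 with toℕ x ≡ᵇ 0 in eq
    ... | true  = x≢0 (toℕ≡0⇒≡0 (ℕ.≡ᵇ⇒≡ _ 0 (subst T (sym eq) _)))
    ... | false = _

  ∑NZ-δ : ∀ {t} (g : Zp p → ℕ) → t ≢ 0# → ∑[ α ∈ NZ ] δ α t ℕ.* g α ≡ g t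
  ∑NZ-δ g t≢0 = ∑-δ _≟_ g (Uniqueₚ.filter⁺ _ (Uniqueₚ.allFin⁺ p)) (Equivalence.from ∈NZ⇔≢0 t≢0)

  ∑NZ-zero : (f : Zp p → ℕ) → (∀ {α} → α ≢ 0# → f α ≡ 0) → ∑ NZ f ≡ 0
  ∑NZ-zero f f≡0 =
    trans (∑-cong-∈ NZ (f≡0 ∘ Equivalence.to ∈NZ⇔≢0)) (trans (∑-const NZ 0) (ℕ.*-zeroʳ (length NZ)))

  ∑U-δ-zero : ∀ e → ∑[ a ∈ U ] δ (a * 0#) e ≡ p ℕ.* δ 0# e
  ∑U-δ-zero e = trans (∑-cong U (λ a → cong (λ z → δ z e) (zeroʳ a))) (∑U-const (δ 0# e))

  ∑U-δ-affine-zero : ∀ c e → ∑[ a ∈ U ] δ (c + a * 0#) e ≡ p ℕ.* δ c e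
  ∑U-δ-affine-zero c e = trans (∑-cong U (λ a → cong (λ z → δ z e) (x+y*0≡x c a))) (∑U-const (δ c e))

module Blocks (p : ℕ) .{{_ : NonZero p}} (p-prime : Prime p) where

  open import Data.Bool using (T)
  open import Data.Empty using (⊥-elim)
  open import Data.Fin using (Fin; _≟_)
  open import Data.Fin.Patterns using (0F; 1F; 2F; 3F; 4F)
  open import Data.List using (List; _++_; map; concatMap; allFin; length)
  open import Data.List.Membership.Propositional using (_∈_)
  open import Data.List.Membership.Propositional.Properties using (∈-allFin; ∈-map⁺; ∈-map⁻)
  open import Data.List.Properties
    using (map-concatMap; concatMap-cong; map-∘; ++-identityʳ; length-map; length-tabulate)
  open import Data.List.Relation.Unary.AllPairs as AllPairs using (AllPairs)
  import Data.List.Relation.Unary.AllPairs.Properties as AllPairsₚ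
  open import Data.List.Relation.Unary.Unique.Propositional using (Unique)
  import Data.List.Relation.Unary.Unique.Propositional.Properties as Uniqueₚ
  open import Data.Nat as ℕ using (_^_)
  import Data.Nat.Properties as ℕ
  open import Data.Product using (_×_; _,_; proj₁; proj₂; uncurry)
  open import Function using (id; _∘_; _⇔_; mk⇔; Equivalence)
  open import Relation.Binary.PropositionalEquality
    using (_≡_; refl; sym; trans; cong; cong₂; subst; module ≡-Reasoning)
  open import Relation.Nullary using (Dec)
  open import Relation.Nullary.Decidable using (_×-dec_)
  open Sums
  open Lists
  open 𝔽ₚ p p-prime
  open ≡-Reasoning

  data Label : Set where
    L₀ : Zp2 p → Label
    L₁ : Sym2 p → Zp2 p → Label
    L₂ L₃ : Zp p → Zp p → Zp p → Label
    L₄ : Zp p → Zp p → Zp p → Zp p → Label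

  block : Label → List (Point p)
  block (L₀ k)       = map (λ κ → (k , κ)) (elemsZp2 p)
  block (L₁ A b)     = map (λ k → (k , affine p A b k)) (elemsZp2 p)
  block (L₂ a b c₀)  = grid (λ k₁ κ₀ → ((c₀ , k₁) , (κ₀ , a * k₁ + b))) U U
  block (L₃ a b c₁)  = grid (λ k₀ κ₁ → ((k₀ , c₁) , (a * k₀ + b , κ₁))) U U
  block (L₄ α β a b) = grid (λ k₀ κ₀ → ((k₀ , α * k₀ + β) , (κ₀ , - α ⁻¹ * κ₀ + a * k₀ + b))) U U

  Incident : Label → Point p → Set
  Incident (L₀ (k₀ , k₁))             ((x₀ , x₁) , _)         = x₀ ≡ k₀ × x₁ ≡ k₁
  Incident (L₁ (a₀₀ , a₀₁ , a₁₁) (b₀ , b₁)) ((x₀ , x₁) , (y₀ , y₁)) =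
    y₀ ≡ a₀₀ * x₀ + a₀₁ * x₁ + b₀ × y₁ ≡ a₀₁ * x₀ + a₁₁ * x₁ + b₁
  Incident (L₂ a b c₀)  ((x₀ , x₁) , (y₀ , y₁)) = x₀ ≡ c₀ × y₁ ≡ a * x₁ + b
  Incident (L₃ a b c₁)  ((x₀ , x₁) , (y₀ , y₁)) = x₁ ≡ c₁ × y₀ ≡ a * x₀ + b
  Incident (L₄ α β a b) ((x₀ , x₁) , (y₀ , y₁)) = x₁ ≡ α * x₀ + β × y₁ ≡ - α ⁻¹ * y₀ + a * x₀ + b

  incident? : ∀ ℓ q → Dec (Incident ℓ q)
  incident? (L₀ (k₀ , k₁))             ((x₀ , x₁) , _)         = (x₀ ≟ k₀) ×-dec (x₁ ≟ k₁)
  incident? (L₁ (a₀₀ , a₀₁ , a₁₁) (b₀ , b₁)) ((x₀ , x₁) , (y₀ , y₁)) =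
    (y₀ ≟ a₀₀ * x₀ + a₀₁ * x₁ + b₀) ×-dec (y₁ ≟ a₀₁ * x₀ + a₁₁ * x₁ + b₁)
  incident? (L₂ a b c₀)  ((x₀ , x₁) , (y₀ , y₁)) = (x₀ ≟ c₀) ×-dec (y₁ ≟ a * x₁ + b)
  incident? (L₃ a b c₁)  ((x₀ , x₁) , (y₀ , y₁)) = (x₁ ≟ c₁) ×-dec (y₀ ≟ a * x₀ + b)
  incident? (L₄ α β a b) ((x₀ , x₁) , (y₀ , y₁)) = (x₁ ≟ α * x₀ + β) ×-dec (y₁ ≟ - α ⁻¹ * y₀ + a * x₀ + b)

  ∈elemsZp2 : ∀ k → k ∈ elemsZp2 p
  ∈elemsZp2 (k₀ , k₁) = ∈-grid⁺ _,_ (∈-allFin k₀) (∈-allFin k₁)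

  ∈allPoints : ∀ q → q ∈ allPoints p
  ∈allPoints (k , κ) = ∈-grid⁺ _,_ (∈elemsZp2 k) (∈elemsZp2 κ)

  ∈block⇒Incident : ∀ ℓ {q} → q ∈ block ℓ → Incident ℓ q
  ∈block⇒Incident (L₀ k) q∈ with _ , _ , refl ← ∈-map⁻ _ q∈ = refl , refl
  ∈block⇒Incident (L₁ (a₀₀ , a₀₁ , a₁₁) (b₀ , b₁)) q∈ with _ , _ , refl ← ∈-map⁻ _ q∈ = refl , refl
  ∈block⇒Incident (L₂ a b c₀)  q∈ with _ , _ , refl ← ∈-grid⁻ _ U U q∈ = refl , refl
  ∈block⇒Incident (L₃ a b c₁)  q∈ with _ , _ , refl ← ∈-grid⁻ _ U U q∈ = refl , refl
  ∈block⇒Incident (L₄ α β a b) q∈ with _ , _ , refl ← ∈-grid⁻ _ U U q∈ = refl , refl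

  Incident⇒∈block : ∀ ℓ {q} → Incident ℓ q → q ∈ block ℓ
  Incident⇒∈block (L₀ k) {k′ , κ} (refl , refl) = ∈-map⁺ _ (∈elemsZp2 κ)
  Incident⇒∈block (L₁ (a₀₀ , a₀₁ , a₁₁) (b₀ , b₁)) {k , _} (refl , refl) = ∈-map⁺ _ (∈elemsZp2 k)
  Incident⇒∈block (L₂ a b c₀)  {(_ , x₁) , (y₀ , _)} (refl , refl) = ∈-grid⁺ _ (∈-allFin x₁) (∈-allFin y₀)
  Incident⇒∈block (L₃ a b c₁)  {(x₀ , _) , (_ , y₁)} (refl , refl) = ∈-grid⁺ _ (∈-allFin x₀) (∈-allFin y₁)
  Incident⇒∈block (L₄ α β a b) {(x₀ , _) , (y₀ , _)} (refl , refl) = ∈-grid⁺ _ (∈-allFin x₀) (∈-allFin y₀)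

  ∈block⇔Incident : ∀ ℓ {q} → q ∈ block ℓ ⇔ Incident ℓ q
  ∈block⇔Incident ℓ = mk⇔ (∈block⇒Incident ℓ) (Incident⇒∈block ℓ)

  point : Label → Zp p → Zp p → Point p
  point (L₀ k)       u v = (k , (u , v))
  point (L₁ A b)     u v = ((u , v) , affine p A b (u , v))
  point (L₂ a b c₀)  u v = ((c₀ , u) , (v , a * u + b))
  point (L₃ a b c₁)  u v = ((u , c₁) , (a * u + b , v))
  point (L₄ α β a b) u v = ((u , α * u + β) , (v , - α ⁻¹ * v + a * u + b))

  point-incident : ∀ ℓ u v → Incident ℓ (point ℓ u v)
  point-incident (L₀ _)       u v = refl , refl
  point-incident (L₁ _ _)     u v = refl , refl
  point-incident (L₂ _ _ _)   u v = refl , refl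
  point-incident (L₃ _ _ _)   u v = refl , refl
  point-incident (L₄ _ _ _ _) u v = refl , refl

  1≡s≡0-elim : ∀ {s} {A : Set} → 1# ≡ s → 0# ≡ s → A
  1≡s≡0-elim 1≡s 0≡s = ⊥-elim (1≢0 (trans 1≡s (sym 0≡s)))

  _⊑_ : Label → Label → Set
  ℓ ⊑ ℓ′ = ∀ u v → Incident ℓ′ (point ℓ u v)

  -- Across families, one block has two points that the other block's equations would force to
  -- agree in a coordinate where they differ by 1#.
  ⊑-antisym : ∀ ℓ ℓ′ → ℓ ⊑ ℓ′ → ℓ′ ⊑ ℓ → ℓ ≡ ℓ′
  ⊑-antisym (L₀ _) (L₀ _) f g = cong L₀ (uncurry (cong₂ _,_) (f 0# 0#))
  ⊑-antisym (L₀ _) (L₁ _ _)     f g = 1≡s≡0-elim (proj₁ (f 1# 0#)) (proj₁ (f 0# 0#))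
  ⊑-antisym (L₀ _) (L₂ _ _ _)   f g = 1≡s≡0-elim (proj₂ (g 1# 0#)) (proj₂ (g 0# 0#))
  ⊑-antisym (L₀ _) (L₃ _ _ _)   f g = 1≡s≡0-elim (proj₁ (g 1# 0#)) (proj₁ (g 0# 0#))
  ⊑-antisym (L₀ _) (L₄ _ _ _ _) f g = 1≡s≡0-elim (proj₁ (g 1# 0#)) (proj₁ (g 0# 0#))
  ⊑-antisym (L₁ _ _) (L₀ _)     f g = 1≡s≡0-elim (proj₁ (g 1# 0#)) (proj₁ (g 0# 0#))
  ⊑-antisym (L₁ (a₀₀ , a₀₁ , a₁₁) (b₀ , b₁)) (L₁ (a₀₀′ , a₀₁′ , a₁₁′) (b₀′ , b₁′)) f g =
    cong₂ L₁ (cong₃ (λ x y z → (x , y , z)) a₀₀≡ a₀₁≡ a₁₁≡) (cong₂ _,_ b₀≡ b₁≡)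
    where
    row₀ = affine₂-injective {a₀₀} {a₀₁} {b₀} {a₀₀′} {a₀₁′} {b₀′}
             (proj₁ (f 0# 0#)) (proj₁ (f 1# 0#)) (proj₁ (f 0# 1#))
    row₁ = affine₂-injective {a₀₁} {a₁₁} {b₁} {a₀₁′} {a₁₁′} {b₁′}
             (proj₂ (f 0# 0#)) (proj₂ (f 1# 0#)) (proj₂ (f 0# 1#))
    a₀₀≡ = proj₁ row₀
    a₀₁≡ = proj₁ (proj₂ row₀)
    b₀≡  = proj₂ (proj₂ row₀)
    a₁₁≡ = proj₁ (proj₂ row₁)
    b₁≡  = proj₂ (proj₂ row₁)
  ⊑-antisym (L₁ _ _) (L₂ _ _ _)   f g = 1≡s≡0-elim (proj₁ (g 0# 1#)) (proj₁ (g 0# 0#))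
  ⊑-antisym (L₁ _ _) (L₃ _ _ _)   f g = 1≡s≡0-elim (proj₂ (g 0# 1#)) (proj₂ (g 0# 0#))
  ⊑-antisym (L₁ _ _) (L₄ _ _ _ _) f g = 1≡s≡0-elim (proj₁ (g 0# 1#)) (proj₁ (g 0# 0#))
  ⊑-antisym (L₂ _ _ _) (L₀ _)     f g = 1≡s≡0-elim (proj₂ (f 1# 0#)) (proj₂ (f 0# 0#))
  ⊑-antisym (L₂ _ _ _) (L₁ _ _)   f g = 1≡s≡0-elim (proj₁ (f 0# 1#)) (proj₁ (f 0# 0#))
  ⊑-antisym (L₂ a b _) (L₂ a′ b′ _) f g =
    uncurry (cong₃ L₂) (affine-injective {a} {b} {a′} {b′} (proj₂ (f 0# 0#)) (proj₂ (f 1# 0#))) (proj₁ (f 0# 0#))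
  ⊑-antisym (L₂ _ _ _) (L₃ _ _ _)   f g = 1≡s≡0-elim (proj₁ (f 1# 0#)) (proj₁ (f 0# 0#))
  ⊑-antisym (L₂ _ _ _) (L₄ _ _ _ _) f g = 1≡s≡0-elim (proj₁ (f 1# 0#)) (proj₁ (f 0# 0#))
  ⊑-antisym (L₃ _ _ _) (L₀ _)     f g = 1≡s≡0-elim (proj₁ (f 1# 0#)) (proj₁ (f 0# 0#))
  ⊑-antisym (L₃ _ _ _) (L₁ _ _)   f g = 1≡s≡0-elim (proj₂ (f 0# 1#)) (proj₂ (f 0# 0#))
  ⊑-antisym (L₃ _ _ _) (L₂ _ _ _) f g = 1≡s≡0-elim (proj₁ (g 1# 0#)) (proj₁ (g 0# 0#))
  ⊑-antisym (L₃ a b _) (L₃ a′ b′ _) f g =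
    uncurry (cong₃ L₃) (affine-injective {a} {b} {a′} {b′} (proj₂ (f 0# 0#)) (proj₂ (f 1# 0#))) (proj₁ (f 0# 0#))
  ⊑-antisym (L₃ _ _ _) (L₄ _ _ _ _) f g = 1≡s≡0-elim (proj₂ (g 0# 1#)) (proj₂ (g 0# 0#))
  ⊑-antisym (L₄ _ _ _ _) (L₀ _)     f g = 1≡s≡0-elim (proj₁ (f 1# 0#)) (proj₁ (f 0# 0#))
  ⊑-antisym (L₄ _ _ _ _) (L₁ _ _)   f g = 1≡s≡0-elim (proj₁ (f 0# 1#)) (proj₁ (f 0# 0#))
  ⊑-antisym (L₄ _ _ _ _) (L₂ _ _ _) f g = 1≡s≡0-elim (proj₁ (g 1# 0#)) (proj₁ (g 0# 0#))
  ⊑-antisym (L₄ _ _ _ _) (L₃ _ _ _) f g = 1≡s≡0-elim (proj₂ (f 0# 1#)) (proj₂ (f 0# 0#))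
  ⊑-antisym (L₄ α β a b) (L₄ α′ β′ a′ b′) f g =
    cong₂ (λ (α , β) (a , b) → L₄ α β a b) (uncurry (cong₂ _,_) αβ≡) (uncurry (cong₂ _,_) ab≡)
    where
    αβ≡ = affine-injective {α} {β} {α′} {β′} (proj₁ (f 0# 0#)) (proj₁ (f 1# 0#))
    ab≡ = proj₂ (affine₂-injective { - α ⁻¹} {a} {b} { - α′ ⁻¹} {a′} {b′}
                  (proj₂ (f 0# 0#)) (proj₂ (f 0# 1#)) (proj₂ (f 1# 0#)))

  T-sameSetᵇ⇒≡ : ∀ {ℓ ℓ′} → T (sameSetᵇ (_≟P_ p) (allPoints p) (block ℓ) (block ℓ′)) → ℓ ≡ ℓ′
  T-sameSetᵇ⇒≡ {ℓ} {ℓ′} same = ⊑-antisym ℓ ℓ′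
    (λ u v → ∈block⇒Incident ℓ′ (Equivalence.to   ℓ⇔ℓ′ (Incident⇒∈block ℓ  (point-incident ℓ  u v))))
    (λ u v → ∈block⇒Incident ℓ  (Equivalence.from ℓ⇔ℓ′ (Incident⇒∈block ℓ′ (point-incident ℓ′ u v))))
    where
    ℓ⇔ℓ′ : ∀ {q} → q ∈ block ℓ ⇔ q ∈ block ℓ′
    ℓ⇔ℓ′ = T-sameSetᵇ⇒⇔ (_≟P_ p) (allPoints p) ∈allPoints same

  -- elemsSym2 enumerates all triples; they parametrise (a , b , c) in 𝓑₂, 𝓑₃ and (β , a , b) in 𝓑₄.
  triples : List (Zp p × Zp p × Zp p)
  triples = elemsSym2 p

  familyLabels : Fin 5 → List Label
  familyLabels 0F = map L₀ (elemsZp2 p)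
  familyLabels 1F = grid L₁ triples (elemsZp2 p)
  familyLabels 2F = map (λ (a , b , c) → L₂ a b c) triples
  familyLabels 3F = map (λ (a , b , c) → L₃ a b c) triples
  familyLabels 4F = grid (λ α (β , a , b) → L₄ α β a b) NZ triples

  labels : List Label
  labels = concatMap familyLabels (allFin 5)

  family : Label → Fin 5
  family (L₀ _)       = 0F
  family (L₁ _ _)     = 1F
  family (L₂ _ _ _)   = 2F
  family (L₃ _ _ _)   = 3F
  family (L₄ _ _ _ _) = 4F

  ∈familyLabels⇒family≡ : ∀ i {ℓ} → ℓ ∈ familyLabels i → family ℓ ≡ i
  ∈familyLabels⇒family≡ 0F ℓ∈ with _ , _ , refl ← ∈-map⁻ _ ℓ∈ = refl
  ∈familyLabels⇒family≡ 1F ℓ∈ with _ , _ , refl ← ∈-grid⁻ _ triples (elemsZp2 p) ℓ∈ = refl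
  ∈familyLabels⇒family≡ 2F ℓ∈ with _ , _ , refl ← ∈-map⁻ _ ℓ∈ = refl
  ∈familyLabels⇒family≡ 3F ℓ∈ with _ , _ , refl ← ∈-map⁻ _ ℓ∈ = refl
  ∈familyLabels⇒family≡ 4F ℓ∈ with _ , _ , refl ← ∈-grid⁻ _ NZ triples ℓ∈ = refl

  U-unique : Unique U
  U-unique = Uniqueₚ.allFin⁺ p

  elemsZp2-unique : Unique (elemsZp2 p)
  elemsZp2-unique = grid-unique _,_ (λ { refl → refl , refl }) U-unique U-unique

  triples-unique : Unique triples
  triples-unique = Unique-concatMap⁺ proj₁ _ first≡ U-unique
    (λ a → grid-unique (λ b c → (a , b , c)) (λ { refl → refl , refl }) U-unique U-unique)
    where
    first≡ : ∀ {a t} → t ∈ grid (λ b c → (a , b , c)) U U → proj₁ t ≡ a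
    first≡ t∈ with _ , _ , refl ← ∈-grid⁻ _ U U t∈ = refl

  familyLabels-unique : ∀ i → Unique (familyLabels i)
  familyLabels-unique 0F = Uniqueₚ.map⁺ (λ { refl → refl }) elemsZp2-unique
  familyLabels-unique 1F = grid-unique L₁ (λ { refl → refl , refl }) triples-unique elemsZp2-unique
  familyLabels-unique 2F = Uniqueₚ.map⁺ (λ { {_ , _ , _} {_ , _ , _} refl → refl }) triples-unique
  familyLabels-unique 3F = Uniqueₚ.map⁺ (λ { {_ , _ , _} {_ , _ , _} refl → refl }) triples-unique
  familyLabels-unique 4F = grid-unique _ (λ { {y = _ , _ , _} {z = _ , _ , _} refl → refl , refl })
                             (Uniqueₚ.filter⁺ _ U-unique) triples-unique

  labels-unique : Unique labels
  labels-unique =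
    Unique-concatMap⁺ family familyLabels (∈familyLabels⇒family≡ _) (Uniqueₚ.allFin⁺ 5) familyLabels-unique

  map-triples : ∀ {B : Set} (h : Zp p × Zp p × Zp p → B) →
                map h triples ≡ concatMap (λ a → grid (λ b c → h (a , b , c)) U U) U
  map-triples h = trans (map-concatMap h _ U) (concatMap-cong (λ a → map-grid h _ U U) U)

  AGtilde≡map-block : AGtilde p ≡ map block labels
  AGtilde≡map-block = sym (trans (map-concatMap block familyLabels (allFin 5))
    (cong₂ _++_ (sym (map-∘ (elemsZp2 p)))
    (cong₂ _++_ (map-grid block L₁ triples (elemsZp2 p))
    (cong₂ _++_ (trans (sym (map-∘ triples)) (map-triples _))
    (cong₂ _++_ (trans (sym (map-∘ triples)) (map-triples _))
    (trans (++-identityʳ _) (trans (map-grid block _ NZ triples) (concatMap-cong (λ α → map-triples _) NZ))))))))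

  blockSet≡AGtilde : blockSet (_≟P_ p) (allPoints p) (AGtilde p) ≡ AGtilde p
  blockSet≡AGtilde = deduplicate-id _ (subst (AllPairs _) (sym AGtilde≡map-block)
    (AllPairsₚ.map⁺ (AllPairs.map (λ ℓ≢ℓ′ same → ℓ≢ℓ′ (T-sameSetᵇ⇒≡ same)) labels-unique)))

  length-U : length U ≡ p
  length-U = length-tabulate {n = p} id

  length-elemsZp2 : length (elemsZp2 p) ≡ p ℕ.* p
  length-elemsZp2 = trans (length-grid _,_ U U) (cong₂ ℕ._*_ length-U length-U)

  block-unique : ∀ ℓ → Unique (block ℓ)
  block-unique (L₀ _)       = Uniqueₚ.map⁺ (λ { refl → refl }) elemsZp2-unique
  block-unique (L₁ _ _)     = Uniqueₚ.map⁺ (cong proj₁) elemsZp2-unique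
  block-unique (L₂ _ _ _)   = grid-unique _ (λ e → cong (proj₂ ∘ proj₁) e , cong (proj₁ ∘ proj₂) e) U-unique U-unique
  block-unique (L₃ _ _ _)   = grid-unique _ (λ e → cong (proj₁ ∘ proj₁) e , cong (proj₂ ∘ proj₂) e) U-unique U-unique
  block-unique (L₄ _ _ _ _) = grid-unique _ (λ e → cong (proj₁ ∘ proj₁) e , cong (proj₁ ∘ proj₂) e) U-unique U-unique

  length-block : ∀ ℓ → length (block ℓ) ≡ p ℕ.* p
  length-block (L₀ _)       = trans (length-map _ (elemsZp2 p)) length-elemsZp2
  length-block (L₁ _ _)     = trans (length-map _ (elemsZp2 p)) length-elemsZp2
  length-block (L₂ _ _ _)   = trans (length-grid _ U U) (cong₂ ℕ._*_ length-U length-U)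
  length-block (L₃ _ _ _)   = trans (length-grid _ U U) (cong₂ ℕ._*_ length-U length-U)
  length-block (L₄ _ _ _ _) = trans (length-grid _ U U) (cong₂ ℕ._*_ length-U length-U)

  card-block : ∀ B → B ∈ blockSet (_≟P_ p) (allPoints p) (AGtilde p) → card (_≟P_ p) (allPoints p) B ≡ p ^ 2
  card-block B B∈ with ℓ , _ , refl ← ∈-map⁻ block (subst (B ∈_) (trans blockSet≡AGtilde AGtilde≡map-block) B∈) =
    trans (card-unique (_≟P_ p) (allPoints p) (block-unique ℓ))
          (trans (length-block ℓ) (cong (p ℕ.*_) (sym (ℕ.*-identityʳ p))))

  card-allPoints : card (_≟P_ p) (allPoints p) (allPoints p) ≡ p ^ 4
  card-allPoints = begin
    card (_≟P_ p) (allPoints p) (allPoints p)   ≡⟨ card-unique (_≟P_ p) (allPoints p) allPoints-unique ⟩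
    length (allPoints p)                        ≡⟨ length-grid _,_ (elemsZp2 p) (elemsZp2 p) ⟩
    length (elemsZp2 p) ℕ.* length (elemsZp2 p) ≡⟨ cong₂ ℕ._*_ length-elemsZp2 length-elemsZp2 ⟩
    (p ℕ.* p) ℕ.* (p ℕ.* p)                     ≡⟨ ℕ.*-assoc p p (p ℕ.* p) ⟩
    p ℕ.* (p ℕ.* (p ℕ.* p))                     ≡⟨ cong (λ n → p ℕ.* (p ℕ.* (p ℕ.* n))) (ℕ.*-identityʳ p) ⟨
    p ^ 4                                       ∎
    where
    allPoints-unique : Unique (allPoints p)
    allPoints-unique = grid-unique _,_ (λ { refl → refl , refl }) elemsZp2-unique elemsZp2-unique

module PairCounts (p : ℕ) .{{_ : NonZero p}} (p-prime : Prime p) where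

  open import Data.Bool using (Bool; _∧_)
  open import Data.Fin using (_≟_)
  open import Data.List using (List; length; filterᵇ)
  open import Data.Nat as ℕ using (ℕ)
  open import Data.Product using (_×_; _,_)
  open import Function using (_∘_)
  open import Function.Construct.Composition using (_⇔-∘_)
  open import Relation.Binary.PropositionalEquality using (_≡_; sym; trans; cong; cong₂; module ≡-Reasoning)
  open Sums
  open Lists
  open 𝔽ₚ p p-prime hiding ([_])
  open Blocks p p-prime
  open ≡-Reasoning

  through : Point p → Point p → List (Point p) → ℕ
  through x y B = bool→ℕ (memᵇ (_≟P_ p) (allPoints p) x B ∧ memᵇ (_≟P_ p) (allPoints p) y B)

  through-block : ∀ ℓ x y → through x y (block ℓ) ≡ 𝟙 (incident? ℓ x) ℕ.* 𝟙 (incident? ℓ y)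
  through-block ℓ x y = trans (bool→ℕ-∧ (mem x) (mem y)) (cong₂ ℕ._*_ (incidence x) (incidence y))
    where
    mem : Point p → Bool
    mem q = memᵇ (_≟P_ p) (allPoints p) q (block ℓ)
    incidence : ∀ q → bool→ℕ (mem q) ≡ 𝟙 (incident? ℓ q)
    incidence q = bool→ℕ-T⇔ (∈block⇔Incident ℓ ⇔-∘ T-memᵇ⇔∈ (_≟P_ p) (allPoints p)) (incident? ℓ q)

  pairCount≡∑through : ∀ x y →
    pairCount (_≟P_ p) (allPoints p) (AGtilde p) x y ≡ ∑[ B ∈ AGtilde p ] through x y B
  pairCount≡∑through x y = trans (cong (length ∘ filterᵇ _) blockSet≡AGtilde) (length-filterᵇ _ (AGtilde p))

  δ-difference : ∀ x x′ → δ x x′ ≡ δ (x′ - x) 0#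
  δ-difference x x′ = 𝟙-cong (x ≟ x′) (x′ - x ≟ 0#) (x≈y⇒x∙y⁻¹≈ε ∘ sym) (sym ∘ x∙y⁻¹≈ε⇒x≈y x′ x)

  ∑-lines-through : ∀ u v w u′ v′ w′ →
    ∑[ a ∈ U ] ∑[ b ∈ U ] ∑[ c ∈ U ] (δ u c ℕ.* δ u′ c) ℕ.* (δ v (a * w + b) ℕ.* δ v′ (a * w′ + b))
      ≡ δ u u′ ℕ.* (∑[ a ∈ U ] δ (a * (w′ - w)) (v′ - v))
  ∑-lines-through u v w u′ v′ w′ = begin
    ∑[ a ∈ U ] ∑[ b ∈ U ] ∑[ c ∈ U ] (δ u c ℕ.* δ u′ c) ℕ.* (δ v (a * w + b) ℕ.* δ v′ (a * w′ + b))
      ≡⟨ ∑-cong U (λ a → ∑-cong U (λ b → trans (∑-*ʳ U _ _) (cong (ℕ._* _) (∑U-δδ u u′)))) ⟩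
    ∑[ a ∈ U ] ∑[ b ∈ U ] δ u u′ ℕ.* (δ v (a * w + b) ℕ.* δ v′ (a * w′ + b))
      ≡⟨ ∑-cong U (λ a → trans (∑-*ˡ U (δ u u′) _)
           (cong (δ u u′ ℕ.*_) (∑U-translation (a * w) v (a * w′) v′))) ⟩
    ∑[ a ∈ U ] δ u u′ ℕ.* δ (a * w′ - a * w) (v′ - v)
      ≡⟨ ∑-*ˡ U (δ u u′) _ ⟩
    δ u u′ ℕ.* (∑[ a ∈ U ] δ (a * w′ - a * w) (v′ - v))
      ≡⟨ cong (δ u u′ ℕ.*_) (∑-cong U (λ a → cong (λ z → δ z (v′ - v)) (sym (x[y-z]≈xy-xz a w′ w)))) ⟩
    δ u u′ ℕ.* (∑[ a ∈ U ] δ (a * (w′ - w)) (v′ - v)) ∎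

  _⊖_ : Point p → Point p → Point p
  ((x₀′ , x₁′) , (y₀′ , y₁′)) ⊖ ((x₀ , x₁) , (y₀ , y₁)) =
    ((x₀′ - x₀ , x₁′ - x₁) , (y₀′ - y₀ , y₁′ - y₁))

  lineCount : Zp p → Zp p → Zp p → ℕ
  lineCount u w v = δ u 0# ℕ.* (∑[ a ∈ U ] δ (a * w) v)

  count₀ count₁ count₂ count₃ count₄ : Point p → ℕ
  count₀ ((d₀ , d₁) , _) = δ d₀ 0# ℕ.* δ d₁ 0#
  count₁ ((d₀ , d₁) , (e₀ , e₁)) =
    ∑[ a₀₀ ∈ U ] ∑[ a₀₁ ∈ U ] ∑[ a₁₁ ∈ U ] δ (a₀₀ * d₀ + a₀₁ * d₁) e₀ ℕ.* δ (a₀₁ * d₀ + a₁₁ * d₁) e₁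
  count₂ ((d₀ , d₁) , (_ , e₁)) = lineCount d₀ d₁ e₁
  count₃ ((d₀ , d₁) , (e₀ , _)) = lineCount d₁ d₀ e₀
  count₄ ((d₀ , d₁) , (e₀ , e₁)) =
    ∑[ α ∈ NZ ] δ (α * d₀) d₁ ℕ.* (∑[ a ∈ U ] δ (- α ⁻¹ * e₀ + a * d₀) e₁)

  through-𝓑₀ : ∀ x x′ → ∑[ B ∈ 𝓑₀ p ] through x x′ B ≡ count₀ (x′ ⊖ x)
  through-𝓑₀ x@((x₀ , x₁) , _) x′@((x₀′ , x₁′) , _) = begin
    ∑[ B ∈ 𝓑₀ p ] through x x′ B
      ≡⟨ trans (∑-map _ (elemsZp2 p) _) (∑-grid _,_ U U _) ⟩
    ∑[ k₀ ∈ U ] ∑[ k₁ ∈ U ] through x x′ (block (L₀ (k₀ , k₁)))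
      ≡⟨ ∑-cong U (λ k₀ → ∑-cong U (λ k₁ → trans (through-block (L₀ (k₀ , k₁)) x x′)
           (𝟙-×-interchange (x₀ ≟ k₀) (x₁ ≟ k₁) (x₀′ ≟ k₀) (x₁′ ≟ k₁)))) ⟩
    ∑[ k₀ ∈ U ] ∑[ k₁ ∈ U ] (δ x₀ k₀ ℕ.* δ x₀′ k₀) ℕ.* (δ x₁ k₁ ℕ.* δ x₁′ k₁)
      ≡⟨ ∑∑-* U U _ _ ⟩
    (∑[ k₀ ∈ U ] δ x₀ k₀ ℕ.* δ x₀′ k₀) ℕ.* (∑[ k₁ ∈ U ] δ x₁ k₁ ℕ.* δ x₁′ k₁)
      ≡⟨ cong₂ ℕ._*_ (trans (∑U-δδ x₀ x₀′) (δ-difference x₀ x₀′))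
                      (trans (∑U-δδ x₁ x₁′) (δ-difference x₁ x₁′)) ⟩
    count₀ (x′ ⊖ x) ∎

  through-𝓑₁ : ∀ x x′ → ∑[ B ∈ 𝓑₁ p ] through x x′ B ≡ count₁ (x′ ⊖ x)
  through-𝓑₁ x@((x₀ , x₁) , (y₀ , y₁)) x′@((x₀′ , x₁′) , (y₀′ , y₁′)) = begin
    ∑[ B ∈ 𝓑₁ p ] through x x′ B
      ≡⟨ ∑-grid (λ A b → block (L₁ A b)) triples (elemsZp2 p) _ ⟩
    ∑[ A ∈ triples ] ∑[ b ∈ elemsZp2 p ] through x x′ (block (L₁ A b))
      ≡⟨ ∑-cong triples (λ A → trans (∑-grid _,_ U U _) (per-matrix A)) ⟩
    ∑[ A ∈ triples ] solutions A
      ≡⟨ ∑-cube (λ a b c → (a , b , c)) U U U solutions ⟩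
    count₁ (x′ ⊖ x) ∎
    where
    solutions : Zp p × Zp p × Zp p → ℕ
    solutions (a₀₀ , a₀₁ , a₁₁) =
      δ (a₀₀ * (x₀′ - x₀) + a₀₁ * (x₁′ - x₁)) (y₀′ - y₀) ℕ.* δ (a₀₁ * (x₀′ - x₀) + a₁₁ * (x₁′ - x₁)) (y₁′ - y₁)
    per-matrix : ∀ A → ∑[ b₀ ∈ U ] ∑[ b₁ ∈ U ] through x x′ (block (L₁ A (b₀ , b₁))) ≡ solutions A
    per-matrix A@(a₀₀ , a₀₁ , a₁₁) = begin
      ∑[ b₀ ∈ U ] ∑[ b₁ ∈ U ] through x x′ (block (L₁ A (b₀ , b₁)))
        ≡⟨ ∑-cong U (λ b₀ → ∑-cong U (λ b₁ → trans (through-block (L₁ A (b₀ , b₁)) x x′)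
             (𝟙-×-interchange (y₀ ≟ a₀₀ * x₀ + a₀₁ * x₁ + b₀) (y₁ ≟ a₀₁ * x₀ + a₁₁ * x₁ + b₁)
                              (y₀′ ≟ a₀₀ * x₀′ + a₀₁ * x₁′ + b₀) (y₁′ ≟ a₀₁ * x₀′ + a₁₁ * x₁′ + b₁)))) ⟩
      ∑[ b₀ ∈ U ] ∑[ b₁ ∈ U ] (δ y₀ (a₀₀ * x₀ + a₀₁ * x₁ + b₀) ℕ.* δ y₀′ (a₀₀ * x₀′ + a₀₁ * x₁′ + b₀))
                            ℕ.* (δ y₁ (a₀₁ * x₀ + a₁₁ * x₁ + b₁) ℕ.* δ y₁′ (a₀₁ * x₀′ + a₁₁ * x₁′ + b₁))
        ≡⟨ ∑∑-* U U _ _ ⟩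
      (∑[ b₀ ∈ U ] δ y₀ (a₀₀ * x₀ + a₀₁ * x₁ + b₀) ℕ.* δ y₀′ (a₀₀ * x₀′ + a₀₁ * x₁′ + b₀))
        ℕ.* (∑[ b₁ ∈ U ] δ y₁ (a₀₁ * x₀ + a₁₁ * x₁ + b₁) ℕ.* δ y₁′ (a₀₁ * x₀′ + a₁₁ * x₁′ + b₁))
        ≡⟨ cong₂ ℕ._*_ (∑U-translation (a₀₀ * x₀ + a₀₁ * x₁) y₀ (a₀₀ * x₀′ + a₀₁ * x₁′) y₀′)
                        (∑U-translation (a₀₁ * x₀ + a₁₁ * x₁) y₁ (a₀₁ * x₀′ + a₁₁ * x₁′) y₁′) ⟩
      δ ((a₀₀ * x₀′ + a₀₁ * x₁′) - (a₀₀ * x₀ + a₀₁ * x₁)) (y₀′ - y₀)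
        ℕ.* δ ((a₀₁ * x₀′ + a₁₁ * x₁′) - (a₀₁ * x₀ + a₁₁ * x₁)) (y₁′ - y₁)
        ≡⟨ cong₂ ℕ._*_ (cong (λ z → δ z (y₀′ - y₀)) (linear-difference a₀₀ a₀₁ x₀′ x₁′ x₀ x₁))
                        (cong (λ z → δ z (y₁′ - y₁)) (linear-difference a₀₁ a₁₁ x₀′ x₁′ x₀ x₁)) ⟩
      solutions A ∎

  through-𝓑₂ : ∀ x x′ → ∑[ B ∈ 𝓑₂ p ] through x x′ B ≡ count₂ (x′ ⊖ x)
  through-𝓑₂ x@((x₀ , x₁) , (y₀ , y₁)) x′@((x₀′ , x₁′) , (y₀′ , y₁′)) = begin
    ∑[ B ∈ 𝓑₂ p ] through x x′ B
      ≡⟨ ∑-cube (λ a b c → block (L₂ a b c)) U U U _ ⟩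
    ∑[ a ∈ U ] ∑[ b ∈ U ] ∑[ c ∈ U ] through x x′ (block (L₂ a b c))
      ≡⟨ ∑-cong U (λ a → ∑-cong U (λ b → ∑-cong U (λ c → trans (through-block (L₂ a b c) x x′)
             (𝟙-×-interchange (x₀ ≟ c) (y₁ ≟ a * x₁ + b) (x₀′ ≟ c) (y₁′ ≟ a * x₁′ + b))))) ⟩
    ∑[ a ∈ U ] ∑[ b ∈ U ] ∑[ c ∈ U ] (δ x₀ c ℕ.* δ x₀′ c) ℕ.* (δ y₁ (a * x₁ + b) ℕ.* δ y₁′ (a * x₁′ + b))
      ≡⟨ ∑-lines-through x₀ y₁ x₁ x₀′ y₁′ x₁′ ⟩
    δ x₀ x₀′ ℕ.* (∑[ a ∈ U ] δ (a * (x₁′ - x₁)) (y₁′ - y₁))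
      ≡⟨ cong (ℕ._* _) (δ-difference x₀ x₀′) ⟩
    count₂ (x′ ⊖ x) ∎

  through-𝓑₃ : ∀ x x′ → ∑[ B ∈ 𝓑₃ p ] through x x′ B ≡ count₃ (x′ ⊖ x)
  through-𝓑₃ x@((x₀ , x₁) , (y₀ , y₁)) x′@((x₀′ , x₁′) , (y₀′ , y₁′)) = begin
    ∑[ B ∈ 𝓑₃ p ] through x x′ B
      ≡⟨ ∑-cube (λ a b c → block (L₃ a b c)) U U U _ ⟩
    ∑[ a ∈ U ] ∑[ b ∈ U ] ∑[ c ∈ U ] through x x′ (block (L₃ a b c))
      ≡⟨ ∑-cong U (λ a → ∑-cong U (λ b → ∑-cong U (λ c → trans (through-block (L₃ a b c) x x′)
             (𝟙-×-interchange (x₁ ≟ c) (y₀ ≟ a * x₀ + b) (x₁′ ≟ c) (y₀′ ≟ a * x₀′ + b))))) ⟩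
    ∑[ a ∈ U ] ∑[ b ∈ U ] ∑[ c ∈ U ] (δ x₁ c ℕ.* δ x₁′ c) ℕ.* (δ y₀ (a * x₀ + b) ℕ.* δ y₀′ (a * x₀′ + b))
      ≡⟨ ∑-lines-through x₁ y₀ x₀ x₁′ y₀′ x₀′ ⟩
    δ x₁ x₁′ ℕ.* (∑[ a ∈ U ] δ (a * (x₀′ - x₀)) (y₀′ - y₀))
      ≡⟨ cong (ℕ._* _) (δ-difference x₁ x₁′) ⟩
    count₃ (x′ ⊖ x) ∎

  through-𝓑₄ : ∀ x x′ → ∑[ B ∈ 𝓑₄ p ] through x x′ B ≡ count₄ (x′ ⊖ x)
  through-𝓑₄ x@((x₀ , x₁) , (y₀ , y₁)) x′@((x₀′ , x₁′) , (y₀′ , y₁′)) =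
    trans (∑-concatMap _ NZ _)
          (∑-cong NZ (λ α → trans (∑-cube (λ β a b → block (L₄ α β a b)) U U U _) (per-slope α)))
    where
    d₀ = x₀′ - x₀
    d₁ = x₁′ - x₁
    e₀ = y₀′ - y₀
    e₁ = y₁′ - y₁
    on-line : Zp p → Zp p → ℕ
    on-line α β = δ x₁ (α * x₀ + β) ℕ.* δ x₁′ (α * x₀′ + β)
    per-slope : ∀ α → ∑[ β ∈ U ] ∑[ a ∈ U ] ∑[ b ∈ U ] through x x′ (block (L₄ α β a b))
                      ≡ δ (α * d₀) d₁ ℕ.* (∑[ a ∈ U ] δ (- α ⁻¹ * e₀ + a * d₀) e₁)
    per-slope α = begin
      ∑[ β ∈ U ] ∑[ a ∈ U ] ∑[ b ∈ U ] through x x′ (block (L₄ α β a b))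
        ≡⟨ ∑-cong U (λ β → ∑-cong U (λ a → ∑-cong U (λ b → trans (through-block (L₄ α β a b) x x′)
             (𝟙-×-interchange (x₁ ≟ α * x₀ + β) (y₁ ≟ - α ⁻¹ * y₀ + a * x₀ + b)
                              (x₁′ ≟ α * x₀′ + β) (y₁′ ≟ - α ⁻¹ * y₀′ + a * x₀′ + b))))) ⟩
      ∑[ β ∈ U ] ∑[ a ∈ U ] ∑[ b ∈ U ]
        on-line α β ℕ.* (δ y₁ (- α ⁻¹ * y₀ + a * x₀ + b) ℕ.* δ y₁′ (- α ⁻¹ * y₀′ + a * x₀′ + b))
        ≡⟨ ∑-cong U (λ β → ∑-cong U (λ a → trans (∑-*ˡ U (on-line α β) _) (cong (on-line α β ℕ.*_)
             (trans (∑U-translation (- α ⁻¹ * y₀ + a * x₀) y₁ (- α ⁻¹ * y₀′ + a * x₀′) y₁′)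
                    (cong (λ z → δ z e₁) (linear-difference (- α ⁻¹) a y₀′ x₀′ y₀ x₀)))))) ⟩
      ∑[ β ∈ U ] ∑[ a ∈ U ] on-line α β ℕ.* δ (- α ⁻¹ * e₀ + a * d₀) e₁
        ≡⟨ ∑∑-* U U (on-line α) (λ a → δ (- α ⁻¹ * e₀ + a * d₀) e₁) ⟩
      (∑[ β ∈ U ] on-line α β) ℕ.* (∑[ a ∈ U ] δ (- α ⁻¹ * e₀ + a * d₀) e₁)
        ≡⟨ cong (ℕ._* (∑[ a ∈ U ] δ (- α ⁻¹ * e₀ + a * d₀) e₁))
             (trans (∑U-translation (α * x₀) x₁ (α * x₀′) x₁′)
                    (cong (λ z → δ z d₁) (sym (x[y-z]≈xy-xz α x₀′ x₀)))) ⟩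
      δ (α * d₀) d₁ ℕ.* (∑[ a ∈ U ] δ (- α ⁻¹ * e₀ + a * d₀) e₁) ∎

module Totals (p : ℕ) .{{_ : NonZero p}} (p-prime : Prime p) where

  open import Data.Empty using (⊥-elim)
  open import Data.Fin using (_≟_)
  open import Data.Nat as ℕ using (ℕ; suc)
  import Data.Nat.Properties as ℕ
  open import Data.Product using (_,_; proj₁; proj₂)
  open import Data.Sum using (_⊎_; inj₁; inj₂; [_,_])
  open import Function using (_∘_; Equivalence)
  open import Relation.Binary.PropositionalEquality
    using (_≡_; _≢_; refl; sym; trans; cong; cong₂; module ≡-Reasoning)
  open import Relation.Nullary using (Dec; yes; no)
  open Sums
  open 𝔽ₚ p p-prime hiding ([_])
  open Blocks p p-prime
  open PairCounts p p-prime
  open ≡-Reasoning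

  count₀-distinct : ∀ {d₀ d₁} e → d₀ ≢ 0# ⊎ d₁ ≢ 0# → count₀ ((d₀ , d₁) , e) ≡ 0
  count₀-distinct {d₀} {d₁} e (inj₁ d₀≢0) = cong (ℕ._* δ d₁ 0#) (δ-≢ d₀≢0)
  count₀-distinct {d₀} {d₁} e (inj₂ d₁≢0) = trans (cong (δ d₀ 0# ℕ.*_) (δ-≢ d₁≢0)) (ℕ.*-zeroʳ (δ d₀ 0#))

  count₁-d₁≢0 : ∀ d₀ {d₁} e₀ e₁ → d₁ ≢ 0# → count₁ ((d₀ , d₁) , (e₀ , e₁)) ≡ p
  count₁-d₁≢0 d₀ {d₁} e₀ e₁ d₁≢0 = begin
    ∑[ a₀₀ ∈ U ] ∑[ a₀₁ ∈ U ] ∑[ a₁₁ ∈ U ] δ (a₀₀ * d₀ + a₀₁ * d₁) e₀ ℕ.* δ (a₀₁ * d₀ + a₁₁ * d₁) e₁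
      ≡⟨ ∑-cong U (λ a₀₀ → ∑-cong U (λ a₀₁ → trans (∑-*ˡ U (δ (a₀₀ * d₀ + a₀₁ * d₁) e₀) _)
           (trans (cong (δ (a₀₀ * d₀ + a₀₁ * d₁) e₀ ℕ.*_) (∑U-δ-affine (a₀₁ * d₀) e₁ d₁≢0))
                  (ℕ.*-identityʳ (δ (a₀₀ * d₀ + a₀₁ * d₁) e₀))))) ⟩
    ∑[ a₀₀ ∈ U ] ∑[ a₀₁ ∈ U ] δ (a₀₀ * d₀ + a₀₁ * d₁) e₀
      ≡⟨ ∑-cong U (λ a₀₀ → ∑U-δ-affine (a₀₀ * d₀) e₀ d₁≢0) ⟩
    ∑[ _ ∈ U ] 1
      ≡⟨ trans (∑U-const 1) (ℕ.*-identityʳ p) ⟩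
    p ∎

  count₁-d₁≡0 : ∀ {d₀} e₀ e₁ → d₀ ≢ 0# → count₁ ((d₀ , 0#) , (e₀ , e₁)) ≡ p
  count₁-d₁≡0 {d₀} e₀ e₁ d₀≢0 = begin
    ∑[ a₀₀ ∈ U ] ∑[ a₀₁ ∈ U ] ∑[ a₁₁ ∈ U ] δ (a₀₀ * d₀ + a₀₁ * 0#) e₀ ℕ.* δ (a₀₁ * d₀ + a₁₁ * 0#) e₁
      ≡⟨ ∑-cong U (λ a₀₀ → ∑-cong U (λ a₀₁ → trans (∑-cong U (λ a₁₁ →
           cong₂ ℕ._*_ (cong (λ z → δ z e₀) (x+y*0≡x (a₀₀ * d₀) a₀₁))
                       (cong (λ z → δ z e₁) (x+y*0≡x (a₀₁ * d₀) a₁₁))))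
           (∑U-const (δ (a₀₀ * d₀) e₀ ℕ.* δ (a₀₁ * d₀) e₁)))) ⟩
    ∑[ a₀₀ ∈ U ] ∑[ a₀₁ ∈ U ] p ℕ.* (δ (a₀₀ * d₀) e₀ ℕ.* δ (a₀₁ * d₀) e₁)
      ≡⟨ trans (∑-cong U (λ a₀₀ → ∑-*ˡ U p (λ a₀₁ → δ (a₀₀ * d₀) e₀ ℕ.* δ (a₀₁ * d₀) e₁)))
               (∑-*ˡ U p (λ a₀₀ → ∑[ a₀₁ ∈ U ] δ (a₀₀ * d₀) e₀ ℕ.* δ (a₀₁ * d₀) e₁)) ⟩
    p ℕ.* (∑[ a₀₀ ∈ U ] ∑[ a₀₁ ∈ U ] δ (a₀₀ * d₀) e₀ ℕ.* δ (a₀₁ * d₀) e₁)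
      ≡⟨ cong (p ℕ.*_) (trans (∑∑-* U U (λ a → δ (a * d₀) e₀) (λ a → δ (a * d₀) e₁))
                              (cong₂ ℕ._*_ (∑U-δ-linear e₀ d₀≢0) (∑U-δ-linear e₁ d₀≢0))) ⟩
    p ℕ.* 1
      ≡⟨ ℕ.*-identityʳ p ⟩
    p ∎

  count₁-same : ∀ {e₀ e₁} → e₀ ≢ 0# ⊎ e₁ ≢ 0# → count₁ ((0# , 0#) , (e₀ , e₁)) ≡ 0
  count₁-same {e₀} {e₁} e≢0 = ∑-zero U (λ a₀₀ → ∑-zero U (λ a₀₁ → ∑-zero U (λ a₁₁ →
    trans (cong₂ ℕ._*_ (cong (λ z → δ z e₀) (x*0+y*0≡0 a₀₀ a₀₁)) (cong (λ z → δ z e₁) (x*0+y*0≡0 a₀₁ a₁₁)))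
          (product≡0 e≢0))))
    where
    x*0+y*0≡0 : ∀ x y → x * 0# + y * 0# ≡ 0#
    x*0+y*0≡0 x y = trans (x+y*0≡x (x * 0#) y) (zeroʳ x)
    product≡0 : e₀ ≢ 0# ⊎ e₁ ≢ 0# → δ 0# e₀ ℕ.* δ 0# e₁ ≡ 0
    product≡0 (inj₁ e₀≢0) = cong (ℕ._* δ 0# e₁) (δ-≢ (e₀≢0 ∘ sym))
    product≡0 (inj₂ e₁≢0) = trans (cong (δ 0# e₀ ℕ.*_) (δ-≢ (e₁≢0 ∘ sym))) (ℕ.*-zeroʳ (δ 0# e₀))

  lineCount-u≢0 : ∀ {u} w v → u ≢ 0# → lineCount u w v ≡ 0
  lineCount-u≢0 w v u≢0 = cong (ℕ._* (∑[ a ∈ U ] δ (a * w) v)) (δ-≢ u≢0)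

  lineCount-w≢0 : ∀ {w} v → w ≢ 0# → lineCount 0# w v ≡ 1
  lineCount-w≢0 v w≢0 = cong₂ ℕ._*_ (δ-≡ {0#} refl) (∑U-δ-linear v w≢0)

  lineCount-same : ∀ v → lineCount 0# 0# v ≡ p ℕ.* δ 0# v
  lineCount-same v = trans (cong₂ ℕ._*_ (δ-≡ {0#} refl) (∑U-δ-zero v)) (ℕ.*-identityˡ (p ℕ.* δ 0# v))

  lineCount-same-≢0 : ∀ {v} → v ≢ 0# → lineCount 0# 0# v ≡ 0
  lineCount-same-≢0 {v} v≢0 =
    trans (lineCount-same v) (trans (cong (p ℕ.*_) (δ-≢ (v≢0 ∘ sym))) (ℕ.*-zeroʳ p))

  lineCount-same-0 : lineCount 0# 0# 0# ≡ p
  lineCount-same-0 = trans (lineCount-same 0#) (trans (cong (p ℕ.*_) (δ-≡ {0#} refl)) (ℕ.*-identityʳ p))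

  count₄-d₀≢0 : ∀ {d₀ d₁} e₀ e₁ → d₀ ≢ 0# →
                count₄ ((d₀ , d₁) , (e₀ , e₁)) ≡ ∑[ α ∈ NZ ] δ (α * d₀) d₁
  count₄-d₀≢0 {d₀} {d₁} e₀ e₁ d₀≢0 = ∑-cong NZ (λ α →
    trans (cong (δ (α * d₀) d₁ ℕ.*_) (∑U-δ-affine (- α ⁻¹ * e₀) e₁ d₀≢0)) (ℕ.*-identityʳ (δ (α * d₀) d₁)))

  ∑NZ-δ-slope : ∀ {d₀ d₁} → d₀ ≢ 0# → d₁ ≢ 0# → ∑[ α ∈ NZ ] δ (α * d₀) d₁ ≡ 1
  ∑NZ-δ-slope {d₀} {d₁} d₀≢0 d₁≢0 = trans
    (∑-cong NZ (λ α →
      trans (𝟙-cong (α * d₀ ≟ d₁) (α ≟ d₁ * d₀ ⁻¹) (x*y≡z⇒x≡z*y⁻¹ d₀≢0) (x≡z*y⁻¹⇒x*y≡z d₀≢0))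
            (sym (ℕ.*-identityʳ (δ α (d₁ * d₀ ⁻¹))))))
    (∑NZ-δ (λ _ → 1) (x*y≢0 d₁≢0 (x⁻¹≢0 d₀≢0)))

  ∑NZ-δ-no-slope : ∀ {d₀} → d₀ ≢ 0# → ∑[ α ∈ NZ ] δ (α * d₀) 0# ≡ 0
  ∑NZ-δ-no-slope d₀≢0 = ∑NZ-zero _ (λ α≢0 → δ-≢ (x*y≢0 α≢0 d₀≢0))

  count₄-vertical : ∀ {d₁} e₀ e₁ → d₁ ≢ 0# → count₄ ((0# , d₁) , (e₀ , e₁)) ≡ 0
  count₄-vertical {d₁} e₀ e₁ d₁≢0 = ∑NZ-zero _ (λ {α} _ →
    cong (ℕ._* (∑[ a ∈ U ] δ (- α ⁻¹ * e₀ + a * 0#) e₁))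
         (δ-≢ (λ α*0≡d₁ → d₁≢0 (trans (sym α*0≡d₁) (zeroʳ α)))))

  count₄-same : ∀ e₀ e₁ → count₄ ((0# , 0#) , (e₀ , e₁)) ≡ ∑[ α ∈ NZ ] δ (- α ⁻¹ * e₀) e₁ ℕ.* p
  count₄-same e₀ e₁ = ∑-cong NZ (λ α →
    trans (cong₂ ℕ._*_ (δ-≡ (zeroʳ α)) (∑U-δ-affine-zero (- α ⁻¹ * e₀) e₁))
          (trans (ℕ.*-identityˡ (p ℕ.* δ (- α ⁻¹ * e₀) e₁)) (ℕ.*-comm p (δ (- α ⁻¹ * e₀) e₁))))

  ∑NZ-δ-e₀≡0 : ∀ {e₁} → e₁ ≢ 0# → ∑[ α ∈ NZ ] δ (- α ⁻¹ * 0#) e₁ ℕ.* p ≡ 0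
  ∑NZ-δ-e₀≡0 {e₁} e₁≢0 =
    ∑NZ-zero _ (λ {α} _ → cong (ℕ._* p) (δ-≢ (λ eq → e₁≢0 (trans (sym eq) (zeroʳ (- α ⁻¹))))))

  ∑NZ-δ-e₁≡0 : ∀ {e₀} → e₀ ≢ 0# → ∑[ α ∈ NZ ] δ (- α ⁻¹ * e₀) 0# ℕ.* p ≡ 0
  ∑NZ-δ-e₁≡0 e₀≢0 = ∑NZ-zero _ (λ α≢0 → cong (ℕ._* p) (δ-≢ (x*y≢0 (-x≢0 (x⁻¹≢0 α≢0)) e₀≢0)))

  ∑NZ-δ-e≢0 : ∀ {e₀ e₁} → e₀ ≢ 0# → e₁ ≢ 0# → ∑[ α ∈ NZ ] δ (- α ⁻¹ * e₀) e₁ ℕ.* p ≡ p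
  ∑NZ-δ-e≢0 {e₀} {e₁} e₀≢0 e₁≢0 = trans
    (∑-cong-∈ NZ (λ {α} α∈NZ → let α≢0 = Equivalence.to ∈NZ⇔≢0 α∈NZ in cong (ℕ._* p)
      (𝟙-cong (- α ⁻¹ * e₀ ≟ e₁) (α ≟ - e₀ * e₁ ⁻¹)
              (-x⁻¹*y≡z⇒x≡-y*z⁻¹ α≢0 e₁≢0) (x≡-y*z⁻¹⇒-x⁻¹*y≡z α≢0 e₁≢0))))
    (∑NZ-δ (λ _ → p) (x*y≢0 (-x≢0 e₀≢0) (x⁻¹≢0 e₁≢0)))

  origin : Point p
  origin = ((0# , 0#) , (0# , 0#))

  total : Point p → ℕ
  total Δ = count₀ Δ ℕ.+ (count₁ Δ ℕ.+ (count₂ Δ ℕ.+ (count₃ Δ ℕ.+ count₄ Δ)))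

  total₂₃₄-same-fibre : ∀ e₀ e₁ → Dec (e₀ ≡ 0#) → Dec (e₁ ≡ 0#) → e₀ ≢ 0# ⊎ e₁ ≢ 0# →
    count₂ ((0# , 0#) , (e₀ , e₁)) ℕ.+ (count₃ ((0# , 0#) , (e₀ , e₁)) ℕ.+ count₄ ((0# , 0#) , (e₀ , e₁))) ≡ p
  total₂₃₄-same-fibre _ _ (yes refl) (yes refl) e≢0 =
    ⊥-elim ([ (λ e₀≢0 → e₀≢0 refl) , (λ e₁≢0 → e₁≢0 refl) ] e≢0)
  total₂₃₄-same-fibre _ e₁ (yes refl) (no e₁≢0) _ =
    trans (cong₂ ℕ._+_ (lineCount-same-≢0 e₁≢0) (cong₂ ℕ._+_ lineCount-same-0
      (trans (count₄-same 0# e₁) (∑NZ-δ-e₀≡0 e₁≢0)))) (ℕ.+-identityʳ p)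
  total₂₃₄-same-fibre e₀ _ (no e₀≢0) (yes refl) _ =
    trans (cong₂ ℕ._+_ lineCount-same-0 (cong₂ ℕ._+_ (lineCount-same-≢0 e₀≢0)
      (trans (count₄-same e₀ 0#) (∑NZ-δ-e₁≡0 e₀≢0)))) (ℕ.+-identityʳ p)
  total₂₃₄-same-fibre e₀ e₁ (no e₀≢0) (no e₁≢0) _ =
    cong₂ ℕ._+_ (lineCount-same-≢0 e₁≢0) (cong₂ ℕ._+_ (lineCount-same-≢0 e₀≢0)
      (trans (count₄-same e₀ e₁) (∑NZ-δ-e≢0 e₀≢0 e₁≢0)))

  total-by-cases : ∀ d₀ d₁ e₀ e₁ → Dec (d₀ ≡ 0#) → Dec (d₁ ≡ 0#) → ((d₀ , d₁) , (e₀ , e₁)) ≢ origin →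
                   total ((d₀ , d₁) , (e₀ , e₁)) ≡ p ℕ.+ 1
  total-by-cases d₀ d₁ e₀ e₁ (no d₀≢0) (no d₁≢0) _ =
    +-cong₅ (count₀-distinct {d₀} {d₁} (e₀ , e₁) (inj₁ d₀≢0)) (count₁-d₁≢0 d₀ {d₁} e₀ e₁ d₁≢0)
            (lineCount-u≢0 d₁ e₁ d₀≢0) (lineCount-u≢0 d₀ e₀ d₁≢0)
            (trans (count₄-d₀≢0 e₀ e₁ d₀≢0) (∑NZ-δ-slope d₀≢0 d₁≢0))
  total-by-cases d₀ _ e₀ e₁ (no d₀≢0) (yes refl) _ =
    +-cong₅ (count₀-distinct {d₀} {0#} (e₀ , e₁) (inj₁ d₀≢0)) (count₁-d₁≡0 {d₀} e₀ e₁ d₀≢0)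
            (lineCount-u≢0 0# e₁ d₀≢0) (lineCount-w≢0 e₀ d₀≢0)
            (trans (count₄-d₀≢0 e₀ e₁ d₀≢0) (∑NZ-δ-no-slope d₀≢0))
  total-by-cases _ d₁ e₀ e₁ (yes refl) (no d₁≢0) _ =
    +-cong₅ (count₀-distinct {0#} {d₁} (e₀ , e₁) (inj₂ d₁≢0)) (count₁-d₁≢0 0# {d₁} e₀ e₁ d₁≢0)
            (lineCount-w≢0 e₁ d₁≢0) (lineCount-u≢0 0# e₀ d₁≢0) (count₄-vertical e₀ e₁ d₁≢0)
  total-by-cases _ _ e₀ e₁ (yes refl) (yes refl) Δ≢0 =
    trans (cong₂ ℕ._+_ (cong₂ ℕ._*_ (δ-≡ {0#} refl) (δ-≡ {0#} refl)) (cong (ℕ._+ rest) (count₁-same e≢0)))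
          (trans (cong suc (total₂₃₄-same-fibre e₀ e₁ (e₀ ≟ 0#) (e₁ ≟ 0#) e≢0)) (ℕ.+-comm 1 p))
    where
    Δ = (0# , 0#) , (e₀ , e₁)
    rest = count₂ Δ ℕ.+ (count₃ Δ ℕ.+ count₄ Δ)
    e≢0 : e₀ ≢ 0# ⊎ e₁ ≢ 0#
    e≢0 with e₀ ≟ 0#
    ... | yes e₀≡0 = inj₂ (λ e₁≡0 → Δ≢0 (cong₂ _,_ refl (cong₂ _,_ e₀≡0 e₁≡0)))
    ... | no e₀≢0  = inj₁ e₀≢0

  ⊖≡origin⇒≡ : ∀ x y → y ⊖ x ≡ origin → y ≡ x
  ⊖≡origin⇒≡ ((x₀ , x₁) , (y₀ , y₁)) ((x₀′ , x₁′) , (y₀′ , y₁′)) eq =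
    cong₂ _,_ (cong₂ _,_ (x∙y⁻¹≈ε⇒x≈y x₀′ x₀ (cong (proj₁ ∘ proj₁) eq))
                         (x∙y⁻¹≈ε⇒x≈y x₁′ x₁ (cong (proj₂ ∘ proj₁) eq)))
              (cong₂ _,_ (x∙y⁻¹≈ε⇒x≈y y₀′ y₀ (cong (proj₁ ∘ proj₂) eq))
                         (x∙y⁻¹≈ε⇒x≈y y₁′ y₁ (cong (proj₂ ∘ proj₂) eq)))

  pairCount≡p+1 : ∀ x y → x ≢ y → pairCount (_≟P_ p) (allPoints p) (AGtilde p) x y ≡ p ℕ.+ 1
  pairCount≡p+1 x y x≢y = begin
    pairCount (_≟P_ p) (allPoints p) (AGtilde p) x y
      ≡⟨ pairCount≡∑through x y ⟩
    ∑[ B ∈ AGtilde p ] through x y B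
      ≡⟨ trans (∑-++ (𝓑₀ p) _ _) (cong (∑ (𝓑₀ p) (through x y) ℕ.+_) (trans (∑-++ (𝓑₁ p) _ _)
           (cong (∑ (𝓑₁ p) (through x y) ℕ.+_) (trans (∑-++ (𝓑₂ p) _ _)
           (cong (∑ (𝓑₂ p) (through x y) ℕ.+_) (∑-++ (𝓑₃ p) (𝓑₄ p) _)))))) ⟩
    (∑[ B ∈ 𝓑₀ p ] through x y B) ℕ.+ ((∑[ B ∈ 𝓑₁ p ] through x y B) ℕ.+ ((∑[ B ∈ 𝓑₂ p ] through x y B)
      ℕ.+ ((∑[ B ∈ 𝓑₃ p ] through x y B) ℕ.+ (∑[ B ∈ 𝓑₄ p ] through x y B))))
      ≡⟨ +-cong₅ (through-𝓑₀ x y) (through-𝓑₁ x y) (through-𝓑₂ x y) (through-𝓑₃ x y) (through-𝓑₄ x y) ⟩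
    total (y ⊖ x)
      ≡⟨ total-by-cases _ _ _ _ (_ ≟ 0#) (_ ≟ 0#) (x≢y ∘ sym ∘ ⊖≡origin⇒≡ x y) ⟩
    p ℕ.+ 1 ∎

open import Data.Nat using (_^_; _+_)
open import Data.Nat.Divisibility using (_∣_)
open import Relation.Nullary using (¬_)

theorem5p8 : (p : ℕ) .{{_ : NonZero p}} → Prime p → ¬ (2 ∣ p) →
    IsBIBD (_≟P_ p) (allPoints p) (AGtilde p) (p ^ 4) (p ^ 2) (p + 1)
theorem5p8 p p-prime _ = record
  { pts-complete = ∈allPoints
  ; pts-size     = card-allPoints
  ; block-size   = card-block
  ; balanced     = pairCount≡p+1
  }
  where
  open Blocks p p-prime
  open Totals p p-prime
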